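{- Let $\mathcal G$ be a class of graphs having bounded tree depth, and let $d\ge 0$. The class $\mathcal G$ has stack depth $d$ if and only if $\mathcal G\equiv\mathcal T_d$ or $\mathcal G\equiv\mathcal F_d$.
   Context: All graphs are finite, simple and undirected, with non-empty vertex set. A graph $\mathbf G$ has vertex set $G$ and symmetric irreflexive edge relation $E^{\mathbf G}$; $\mathrm{refl}(E^{\mathbf G})=E^{\mathbf G}\cup\{(g,g)\mid g\in G\}$. For graphs $\mathbf G,\mathbf H$, an $\mathbf H$-deconstruction of $\mathbf G$ is a family $(B_h)_{h\in H}$ of subsets of $G$ such that: (Coverage) for each $(g,g')\in\mathrm{refl}(E^{\mathbf G})$ there is $(h,h')\in\mathrm{refl}(E^{\mathbf H})$ with $\{g,g'\}\subseteq B_h\cup B_{h'}$; (Connectivity) for each $g\in G$ the set $\{h\mid g\in B_h\}$ is connected in $\mathbf H$. Its width is $\max_{(h,h')\in\mathrm{refl}(E^{\mathbf H})}|B_h\cup B_{h'}|$. For classes of graphs, $\mathcal G\preceq\mathcal H$ means there is a constant $k\ge1$ such that for each $\mathbf G\in\mathcal G$ there is $\mathbf H\in\mathcal H$ such that $\mathbf G$ has an $\mathbf H$-deconstruction of width $\le k$; $\mathcal G\equiv\mathcal H$ means $\mathcal G\preceq\mathcal H$ and $\mathcal H\preceq\mathcal G$. The height of a rooted tree is the maximum number of edges on a path from the root to a vertex; the height of a tree is the minimum height over all rootings; the height of a forest is the maximum height of its components. $\mathcal T_d$ and $\mathcal F_d$ are the classes of trees, respectively forests, of height at most $d$. The tree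 depth of a connected graph $\mathbf G$ is the least $h\in\mathbb N$ such that there is a rooted tree on vertex set $G$ of height $\le h$ such that for every edge of $\mathbf G$ one endpoint is an ancestor of the other in the rooted tree; the tree depth of a graph is the maximum over its components. $\mathcal G$ has bounded tree depth if there is a common upper bound on the tree depths of its members. A graph $\mathbf M$ is a minor of a graph $\mathbf G$ if there is a map $\mu$ assigning to the vertices $m$ of $\mathbf M$ pairwise disjoint, non-empty, connected subsets $\mu(m)$ of $G$ such that for each edge $(m,m')$ of $\mathbf M$ there are $g\in\mu(m)$, $g'\in\mu(m')$ with $(g,g')\in E^{\mathbf G}$. $\mathrm{minors}(\mathcal G)$ is the class of all graphs that are minors of some graph in $\mathcal G$. For $h\ge0,k\ge1$, $\mathbf T_{h,k}$ is the tree whose vertices are the strings of length $\le h$ over the alphabet $\{1,\dots,k\}$, with an edge between $t$ and $ti$ for each string $t$ of length $<h$ and each $i\in\{1,\dots,k\}$. The stack depth of $\mathcal G$ is $\max\{h\mid \forall k\ge1:\ \mathbf T_{h,k}\in\mathrm{minors}(\mathcal G)\}$ (and $\infty$ if this set is infinite). -}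

module Defs where

open import Data.Bool using (Bool; true; false; T; _∨_)
open import Data.Bool.Properties using (∨-comm)
open import Data.Fin using (Fin)
import Data.Fin.Properties as Fin
open import Data.Fin.Subset using (Subset; _∈_; _⊆_; _∩_; _∪_; ∣_∣; Nonempty; Empty)
open import Data.Fin.Subset.Properties using (_∈?_)
open import Data.List using (List; []; _∷_; _∷ʳ_; length; lookup; map; concatMap; filter; allFin)
import Data.List.Membership.Propositional as List
open import Data.List.Properties using (≡-dec; length-++)
open import Data.List.Relation.Unary.Unique.Propositional using (Unique)
open import Data.Nat using (ℕ; zero; suc; _≤_; NonZero)
open import Data.Nat.Properties using (m+1+n≢m)
open import Data.Product using (∃; ∃-syntax; Σ-syntax; _×_; _,_)
open import Data.Sum using (_⊎_)
open import Data.Unit using (⊤)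
open import Level using (Level; 0ℓ; _⊔_)
open import Relation.Binary.Core using (Rel)
open import Relation.Binary.Construct.Closure.ReflexiveTransitive using (Star; ε; _◅_)
open import Relation.Binary.PropositionalEquality
  using (_≡_; _≢_; refl; sym; trans; cong)
open import Relation.Nullary using (¬_; Dec; yes; no; ⌊_⌋; contradiction)
open import Relation.Unary using (Pred)

private variable
  ℓ ℓ₁ ℓ₂ : Level
  m n : ℕ

IsMax : Pred ℕ ℓ → Pred ℕ ℓ
IsMax P m = P m × (∀ n → P n → n ≤ m)

IsMin : Pred ℕ ℓ → Pred ℕ ℓ
IsMin P m = P m × (∀ n → P n → m ≤ n)

-- The vertex set is `Fin n`; every notion below is invariant under
-- isomorphism, so this loses no generality.  Here `n` may be zero:
-- non-emptiness is part of `Graph`.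
record GraphOn (n : ℕ) : Set where
  field
    adj    : Fin n → Fin n → Bool
    symm   : ∀ g g′ → adj g g′ ≡ adj g′ g
    irrefl : ∀ g → adj g g ≡ false

  E : Rel (Fin n) 0ℓ
  E g g′ = T (adj g g′)

  ReflE : Rel (Fin n) 0ℓ
  ReflE g g′ = E g g′ ⊎ g ≡ g′

open GraphOn public using (E; ReflE)

record Graph : Set where
  constructor mkGraph
  field
    order       : ℕ
    {{nonEmpty}} : NonZero order
    graph       : GraphOn order

open Graph public using (order; graph)

GraphClass : (ℓ : Level) → Set (Level.suc ℓ)
GraphClass ℓ = Pred Graph ℓ

-- The empty set counts as connected; non-emptiness is demanded
-- separately wherever it matters.
ConnectedSet : GraphOn n → Pred (Fin n) 0ℓ → Set
ConnectedSet G S =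
  ∀ {u v} → S u → S v → Star (λ x y → S x × S y × E G x y) u v

Connected : GraphOn n → Set
Connected G = ConnectedSet G (λ _ → ⊤)

Component : GraphOn n → Subset n → Set
Component {n} G C =
    Nonempty C
  × ConnectedSet G (_∈ C)
  × (∀ (D : Subset n) → ConnectedSet G (_∈ D) → C ⊆ D → D ⊆ C)

elements : Subset n → List (Fin n)
elements {n} C = filter (_∈? C) (allFin n)

-- The subgraph induced on C; its i-th vertex stands for the i-th
-- element of C.
induced : GraphOn n → (C : Subset n) → GraphOn (length (elements C))
induced G C = record
  { adj    = λ i j → GraphOn.adj G (lookup (elements C) i) (lookup (elements C) j)
  ; symm   = λ i j → GraphOn.symm G _ _
  ; irrefl = λ i → GraphOn.irrefl G _
  }

Walk : GraphOn n → Fin n → Fin n → Set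
Walk G = Star (E G)

edges : ∀ {R : Rel (Fin n) 0ℓ} {u v} → Star R u v → ℕ
edges ε       = 0
edges (_ ◅ p) = suc (edges p)

vertices : ∀ {R : Rel (Fin n) 0ℓ} {u v} → Star R u v → List (Fin n)
vertices {u = u} ε       = u ∷ []
vertices {u = u} (_ ◅ p) = u ∷ vertices p

IsPath : ∀ {R : Rel (Fin n) 0ℓ} {u v} → Star R u v → Set
IsPath p = Unique (vertices p)

-- A cycle is a path with at least two edges whose endpoints are adjacent.
Acyclic : GraphOn n → Set
Acyclic G = ∀ {u v} (p : Walk G u v) → IsPath p → 2 ≤ edges p → ¬ E G v u

Tree : GraphOn n → Set
Tree G = Connected G × Acyclic G

Forest : GraphOn n → Set
Forest G = Acyclic G

RootedHeight : GraphOn n → Fin n → ℕ → Set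
RootedHeight G r = IsMax λ l → ∃[ v ] Σ[ p ∈ Walk G r v ] IsPath p × edges p ≡ l

TreeHeight : GraphOn n → ℕ → Set
TreeHeight G = IsMin λ l → ∃[ r ] RootedHeight G r l

ForestHeight : GraphOn n → ℕ → Set
ForestHeight G = IsMax λ l → ∃[ C ] Component G C × TreeHeight (induced G C) l

𝒯 : ℕ → GraphClass 0ℓ
𝒯 d G = Tree (graph G) × ∃[ h ] TreeHeight (graph G) h × h ≤ d

ℱ : ℕ → GraphClass 0ℓ
ℱ d G = Forest (graph G) × ∃[ h ] ForestHeight (graph G) h × h ≤ d

record Deconstruction (H : GraphOn m) (G : GraphOn n) : Set where
  field
    B            : Fin m → Subset n
    coverage     : ∀ {g g′} → ReflE G g g′ →
                   ∃[ h ] ∃[ h′ ] ReflE H h h′ × g ∈ (B h ∪ B h′) × g′ ∈ (B h ∪ B h′)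
    connectivity : ∀ g → ConnectedSet H (λ h → g ∈ B h)

  Width : ℕ → Set
  Width = IsMax λ w → ∃[ h ] ∃[ h′ ] ReflE H h h′ × ∣ B h ∪ B h′ ∣ ≡ w

infix 4 _≼_ _≋_

_≼_ : GraphClass ℓ₁ → GraphClass ℓ₂ → Set (ℓ₁ ⊔ ℓ₂)
𝒢 ≼ ℋ =
  ∃[ k ] 1 ≤ k × (∀ G → 𝒢 G →
    ∃[ H ] ℋ H × Σ[ D ∈ Deconstruction (graph H) (graph G) ]
      ∃[ w ] Deconstruction.Width D w × w ≤ k)

_≋_ : GraphClass ℓ₁ → GraphClass ℓ₂ → Set (ℓ₁ ⊔ ℓ₂)
𝒢 ≋ ℋ = 𝒢 ≼ ℋ × ℋ ≼ 𝒢

-- A vertex counts as its own ancestor, which does not matter for edges.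
Ancestor : (T : GraphOn n) (r : Fin n) → Fin n → Fin n → Set
Ancestor T r u v = Σ[ p ∈ Walk T r v ] IsPath p × u List.∈ vertices p

ConnectedTreeDepth : GraphOn n → ℕ → Set
ConnectedTreeDepth {n} G = IsMin λ h →
  Σ[ T ∈ GraphOn n ] Tree T × Σ[ r ∈ Fin n ]
      (∃[ l ] RootedHeight T r l × l ≤ h)
    × (∀ u v → E G u v → Ancestor T r u v ⊎ Ancestor T r v u)

TreeDepth : GraphOn n → ℕ → Set
TreeDepth G = IsMax λ h → ∃[ C ] Component G C × ConnectedTreeDepth (induced G C) h

BoundedTreeDepth : GraphClass ℓ → Set ℓ
BoundedTreeDepth 𝒢 = ∃[ b ] ∀ G → 𝒢 G → ∃[ h ] TreeDepth (graph G) h × h ≤ b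

record Minor (M : GraphOn m) (G : GraphOn n) : Set where
  field
    μ         : Fin m → Subset n
    disjoint  : ∀ {i j} → i ≢ j → Empty (μ i ∩ μ j)
    nonempty  : ∀ i → Nonempty (μ i)
    connected : ∀ i → ConnectedSet G (_∈ μ i)
    edge      : ∀ {i j} → E M i j → ∃[ g ] ∃[ g′ ] g ∈ μ i × g′ ∈ μ j × E G g g′

minors : GraphClass ℓ → GraphClass ℓ
minors 𝒢 M = ∃[ G ] 𝒢 G × Minor (graph M) (graph G)

-- The strings of length ≤ h over the alphabet Fin k, each listed once.
mutual
  strings : (h k : ℕ) → List (List (Fin k))
  strings h k = [] ∷ nonEmptyStrings h k

  nonEmptyStrings : (h k : ℕ) → List (List (Fin k))
  nonEmptyStrings zero    k = []
  nonEmptyStrings (suc h) k = concatMap (λ i → map (i ∷_) (strings h k)) (allFin k)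

module _ {k : ℕ} where

  Child : List (Fin k) → List (Fin k) → Set
  Child t s = ∃[ i ] s ≡ t ∷ʳ i

  child? : ∀ t s → Dec (Child t s)
  child? t s = Fin.any? λ i → ≡-dec Fin._≟_ s (t ∷ʳ i)

  ¬child-self : ∀ t → ¬ Child t t
  ¬child-self t (i , eq) =
    m+1+n≢m (length t) (sym (trans (cong length eq) (length-++ t)))

  adjacent : List (Fin k) → List (Fin k) → Bool
  adjacent t s = ⌊ child? t s ⌋ ∨ ⌊ child? s t ⌋

  adjacent-irrefl : ∀ t → adjacent t t ≡ false
  adjacent-irrefl t with child? t t
  ... | yes c = contradiction c (¬child-self t)
  ... | no _  = refl

-- The vertices are the positions in `strings h k`, standing for the
-- strings found there.
𝐓 : (h k : ℕ) → Graph
𝐓 h k = mkGraph (length (strings h k)) record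
  { adj    = λ i j → adjacent (lookup (strings h k) i) (lookup (strings h k) j)
  ; symm   = λ i j → ∨-comm ⌊ child? (lookup (strings h k) i) (lookup (strings h k) j) ⌋ _
  ; irrefl = λ i → adjacent-irrefl (lookup (strings h k) i)
  }

-- A maximum of an empty or unbounded set does not exist, so no natural
-- number is the stack depth in those cases.
StackDepth : GraphClass ℓ → ℕ → Set ℓ
StackDepth 𝒢 = IsMax λ h → ∀ k → 1 ≤ k → minors 𝒢 (𝐓 h k)

-- Call a vertex set shattered to depth d + 1 with budget w if at most w vertices
-- can be deleted from it so that all connected pieces of what remains are
-- shattered to depth d; no nonempty piece is shattered to depth 0.  Deleting bags
-- from the root down shows that an ℱ d-deconstruction of bounded width shatters
-- every connected set to depth d + 1 with bounded budget; conversely, the deleted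
-- sets, passed on to all descendants, are the bags of such a deconstruction.
-- Shattering pulls back along deconstructions, in particular along minors, and
-- 𝐓 h k is not shattered to any depth d ≤ h with a budget below k.
--
-- By induction on the tree depth, a connected set without a model of 𝐓 d k is
-- shattered to depth d with a budget depending only on d, k and the tree depth:
-- delete the root of an elimination tree together with the first deleted sets of
-- those components that contain a model of 𝐓 (d - 1) (k + 1).  There are fewer
-- than k of them, and all others are shattered to depth d - 1.
--
-- If 𝒢 has stack depth d, this gives 𝒢 ≼ ℱ d.  Either some graphs in 𝒢 have
-- arbitrarily many components with large models of 𝐓 d k, whence ℱ d ≼ 𝒢; or few
-- components have one, and merging their first deleted sets into a single root
-- bag gives 𝒢 ≼ 𝒯 d.

module Submission where

open import Axiom.ExcludedMiddle using (ExcludedMiddle)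
open import Data.Bool using (T)
open import Data.Bool.Properties using (∨-comm; T-∨)
open import Data.Empty using (⊥)
open import Data.Fin using (Fin; zero; suc; toℕ; punchIn; inject₁)
import Data.Fin as Fin using (_<_)
import Data.Fin.Properties as Fin
open import Data.Fin.Subset
  using (Subset; inside; outside; _∈_; _∉_; _⊆_; _∪_; ⁅_⁆; ∣_∣; Nonempty)
  renaming (⊤ to full; ⊥ to ∅)
open import Data.Fin.Subset.Properties
  using ( _∈?_; ∈⊤; x∈⁅x⁆; x∈⁅y⁆⇒x≡y; x∈p∩q⁺; x∈p∩q⁻; x∈p∪q⁺; x∈p∪q⁻
        ; p⊆q⇒∣p∣≤∣q∣; ∣p∣≤∣p∪q∣; ∣⊥∣≡0; ∣⁅x⁆∣≡1)
open import Data.List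
  using (List; []; _∷_; _++_; _∷ʳ_; length; lookup; map; concatMap; allFin; drop; initLast; _∷ʳ′_)
import Data.List.Membership.Propositional as List
open import Data.List.Membership.Propositional.Properties
  using ( ∈-++⁺ˡ; ∈-++⁺ʳ; ∈-map⁺; ∈-map⁻; ∈-concatMap⁺; ∈-concatMap⁻
        ; ∈-lookup; ∈-allFin; ∈-filter⁺; ∈-filter⁻)
open import Data.List.Properties
  using ( length-++; length-map; ++-assoc; ++-cancelˡ; ++-identityʳ
        ; ∷ʳ-injectiveˡ; ∷-injectiveˡ; ∷-injectiveʳ)
import Data.List.Relation.Unary.All as All
import Data.List.Relation.Unary.All.Properties as All
import Data.List.Relation.Unary.AllPairs as AllPairs
import Data.List.Relation.Unary.AllPairs.Properties as AllPairs
open import Data.List.Relation.Unary.Any using (here; there)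
import Data.List.Relation.Unary.Any as Any
import Data.List.Relation.Unary.Any.Properties as Any
open import Data.List.Relation.Unary.Unique.Propositional using (Unique; _∷_)
import Data.List.Relation.Unary.Unique.Propositional.Properties as Unique
open import Data.List.Reverse using (Reverse; []; _∶_∶ʳ_; reverseView)
open import Data.Nat using (ℕ; zero; suc; _+_; _*_; _≤_; _<_; z≤n; s≤s)
open import Data.Nat.Properties
  using ( ≤-refl; ≤-trans; ≤-reflexive; ≤-antisym; ≤-pred; ≤∧≢⇒<; ≰⇒>; <-irrefl
        ; n≤1+n; m≤n⇒m≤1+n; m≤m+n; m≤n+m; m+1+n≢m; +-suc; +-comm; +-mono-≤; *-monoˡ-≤)
open import Data.Product using (∃; ∃-syntax; Σ-syntax; _×_; _,_; proj₁; proj₂)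
open import Data.Sum using (_⊎_; inj₁; inj₂; [_,_]′)
import Data.Sum as Sum
open import Data.Unit using (tt)
open import Data.Vec using ([]; _∷_; here; there; tabulate)
open import Data.Vec.Properties using (lookup∘tabulate; []=⇒lookup; lookup⇒[]=)
open import Function using (_∘_; id; const)
open import Function.Bundles using (_⇔_; mk⇔; Equivalence)
open import Level using (Level; 0ℓ; Lift; lift; lower)
open import Relation.Binary.Construct.Closure.ReflexiveTransitive
  using (Star; ε; _◅_; _◅◅_; reverse)
import Relation.Binary.Construct.Closure.ReflexiveTransitive as Star
open import Relation.Binary.Core using (Rel)
open import Relation.Binary.PropositionalEquality
  using (_≡_; _≢_; refl; sym; trans; cong; subst; subst₂)
open import Relation.Nullary using (¬_; Dec; yes; no; does; ⌊_⌋; contradiction)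
import Relation.Nullary.Decidable as Dec
open import Relation.Unary using (Pred)
open import Defs

private variable
  ℓ ℓ′ : Level
  k m n : ℕ
  A : Set
  G : GraphOn n

-- Only statements quantifying over the class live at level `ℓ`; single graphs are treated at level
-- 0.
excludedMiddle₀ : ExcludedMiddle ℓ → ExcludedMiddle 0ℓ
excludedMiddle₀ {ℓ} em {P} = Dec.map′ lower lift (em {Lift ℓ P})

-- Sizes of finite subsets

∣p∪q∣≤ : (p q : Subset n) → ∣ p ∪ q ∣ ≤ ∣ p ∣ + ∣ q ∣
∣p∪q∣≤ []            []            = z≤n
∣p∪q∣≤ (inside  ∷ p) (inside  ∷ q) =
    s≤s (≤-trans (∣p∪q∣≤ p q) (+-mono-≤ (≤-refl {∣ p ∣}) (m≤n⇒m≤1+n ≤-refl)))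
∣p∪q∣≤ (inside  ∷ p) (outside ∷ q) = s≤s (∣p∪q∣≤ p q)
∣p∪q∣≤ (outside ∷ p) (inside  ∷ q) =
  subst (suc ∣ p ∪ q ∣ ≤_) (sym (+-suc ∣ p ∣ ∣ q ∣)) (s≤s (∣p∪q∣≤ p q))
∣p∪q∣≤ (outside ∷ p) (outside ∷ q) = ∣p∪q∣≤ p q

∣p∣≤length : (p : Subset n) (xs : List (Fin n)) → (∀ {x} → x ∈ p → x List.∈ xs) → ∣ p ∣ ≤ length xs
∣p∣≤length {n} p xs p⊆xs = ≤-trans (p⊆q⇒∣p∣≤∣q∣ (λ x∈p → listed xs (p⊆xs x∈p))) (size xs)
  where
  ⋃⁅_⁆ : List (Fin n) → Subset n
  ⋃⁅ [] ⁆     = ∅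
  ⋃⁅ x ∷ xs ⁆ = ⁅ x ⁆ ∪ ⋃⁅ xs ⁆

  listed : ∀ xs {x} → x List.∈ xs → x ∈ ⋃⁅ xs ⁆
  listed (y ∷ ys) (here refl) = x∈p∪q⁺ (inj₁ (x∈⁅x⁆ y))
  listed (y ∷ ys) (there x∈)  = x∈p∪q⁺ (inj₂ (listed ys x∈))

  size : ∀ xs → ∣ ⋃⁅ xs ⁆ ∣ ≤ length xs
  size []       = ≤-reflexive (∣⊥∣≡0 n)
  size (x ∷ xs) = ≤-trans (∣p∪q∣≤ ⁅ x ⁆ ⋃⁅ xs ⁆) (+-mono-≤ (≤-reflexive (∣⁅x⁆∣≡1 x)) (size xs))

members : (p : Subset n) → ∃[ xs ] length xs ≡ ∣ p ∣ × (∀ {x} → x ∈ p → x List.∈ xs)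
members [] = [] , refl , λ ()
members (inside ∷ p) with members p
... | xs , len , all = zero ∷ map suc xs , cong suc (trans (length-map suc xs) len)
                     , λ { here → here refl ; (there x∈p) → there (∈-map⁺ suc (all x∈p)) }
members (outside ∷ p) with members p
... | xs , len , all = map suc xs , trans (length-map suc xs) len
                     , λ { (there x∈p) → ∈-map⁺ suc (all x∈p) }

-- Connected sets, pieces and shattering

adj-sym : (G : GraphOn n) → ∀ {x y} → E G x y → E G y x
adj-sym G {x} {y} = subst T (GraphOn.symm G x y)

¬adj-refl : (G : GraphOn n) → ∀ {x} → ¬ E G x x
¬adj-refl G {x} = subst T (GraphOn.irrefl G x)

Reach : GraphOn n → Subset n → Fin n → Fin n → Set
Reach G X = Star (λ x y → x ∈ X × y ∈ X × E G x y)

Conn : GraphOn n → Subset n → Set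
Conn G X = ConnectedSet G (_∈ X)

module _ (G : GraphOn n) where

  reach-sym : ∀ {X x y} → Reach G X x y → Reach G X y x
  reach-sym = reverse (λ (x∈X , y∈X , e) → y∈X , x∈X , adj-sym G e)

  reach-mono : ∀ {X Y x y} → X ⊆ Y → Reach G X x y → Reach G Y x y
  reach-mono X⊆Y = Star.map (λ (x∈X , y∈X , e) → X⊆Y x∈X , X⊆Y y∈X , e)

  conn-from : ∀ {X} u → (∀ {x} → x ∈ X → Reach G X u x) → Conn G X
  conn-from u reach x∈X y∈X = reach-sym (reach x∈X) ◅◅ reach y∈X

  conn-∪ : ∀ {X Y x y} → Conn G X → Conn G Y → x ∈ X → y ∈ Y → E G x y → Conn G (X ∪ Y)
  conn-∪ {X} {Y} {x} {y} cX cY x∈X y∈Y e = conn-from x reach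
    where
    reach : ∀ {z} → z ∈ X ∪ Y → Reach G (X ∪ Y) x z
    reach z∈ with x∈p∪q⁻ X Y z∈
    ... | inj₁ z∈X = reach-mono (λ q → x∈p∪q⁺ (inj₁ q)) (cX x∈X z∈X)
    ... | inj₂ z∈Y = (x∈p∪q⁺ (inj₁ x∈X) , x∈p∪q⁺ (inj₂ y∈Y) , e)
                     ◅ reach-mono (λ q → x∈p∪q⁺ (inj₂ q)) (cY y∈Y z∈Y)

  conn-⁅⁆ : ∀ x → Conn G ⁅ x ⁆
  conn-⁅⁆ x {u} {v} u∈ v∈ with refl ← x∈⁅y⁆⇒x≡y x u∈ | refl ← x∈⁅y⁆⇒x≡y x v∈ = ε

-- For `C ⊆ X` this says that `C` is a union of components of the graph induced on `X`.
Closed : GraphOn n → Subset n → Subset n → Set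
Closed G C X = ∀ {u v} → u ∈ C → v ∈ X → E G u v → v ∈ C

-- Pieces are arbitrary connected subsets rather than components, so that shattering passes to
-- subsets without any comparison of components.
record Piece (G : GraphOn n) (X Y : Subset n) : Set where
  constructor piece
  field
    inhabited : Nonempty Y
    conn      : Conn G Y
    sub       : Y ⊆ X

piece-mono : ∀ {G : GraphOn n} {X X′ Y} → X ⊆ X′ → Piece G X Y → Piece G X′ Y
piece-mono X⊆X′ (piece ne c Y⊆X) = piece ne c (X⊆X′ ∘ Y⊆X)

Avoids : List (Fin n) → Subset n → Set
Avoids S Y = ∀ {y} → y ∈ Y → ¬ y List.∈ S

-- The depth is shifted by one: depth suc d corresponds to trees of height d.
Shattered : GraphOn n → ℕ → ℕ → Subset n → Set
Shattered G zero    w X = ⊥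
Shattered G (suc d) w X =
  ∃[ S ] length S ≤ w × (∀ Y → Piece G X Y → Avoids S Y → Shattered G d w Y)

shattered-mono : ∀ {G : GraphOn n} d {w w′ X Y} → w ≤ w′ → Y ⊆ X →
                 Shattered G d w X → Shattered G d w′ Y
shattered-mono (suc d) w≤w′ Y⊆X (S , S≤w , f) =
  S , ≤-trans S≤w w≤w′ ,
  λ Z p a → shattered-mono d w≤w′ id (f Z (piece-mono Y⊆X p) a)

-- Comprehension, components and families of components

module Classical (em : ExcludedMiddle 0ℓ) where

  ⟦_⟧ : Pred (Fin n) 0ℓ → Subset n
  ⟦ P ⟧ = tabulate (λ x → does (em {P x}))

  ∈⟦⟧⁺ : ∀ {P : Pred (Fin n) 0ℓ} {x} → P x → x ∈ ⟦ P ⟧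
  ∈⟦⟧⁺ {P = P} {x} px = lookup⇒[]= x ⟦ P ⟧ (trans (lookup∘tabulate _ x) (Dec.dec-true em px))

  ∈⟦⟧⁻ : ∀ {P : Pred (Fin n) 0ℓ} {x} → x ∈ ⟦ P ⟧ → P x
  ∈⟦⟧⁻ {P = P} {x} x∈ with em {P x} | trans (sym (lookup∘tabulate (λ y → does (em {P y})) x))
      ([]=⇒lookup x∈)
  ... | yes px | _ = px
  ... | no _   | ()

  conn-⟦⟧ : (G : GraphOn n) (P : Pred (Fin n) 0ℓ) → ConnectedSet G P → Conn G ⟦ P ⟧
  conn-⟦⟧ G P c u∈ v∈ = Star.map (λ (pu , pv , e) → ∈⟦⟧⁺ {P = P} pu , ∈⟦⟧⁺ {P = P} pv , e)
      (c (∈⟦⟧⁻ {P = P} u∈) (∈⟦⟧⁻ {P = P} v∈))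

  by-contradiction : {P : Set} → ¬ ¬ P → P
  by-contradiction = Dec.decidable-stable em

  max-exists : (P : Pred ℕ 0ℓ) (b : ℕ) → (∀ n → P n → n ≤ b) → ∃ P → ∃ (IsMax P)
  max-exists P b bound (n , pn) with em {P b}
  ... | yes pb = b , pb , bound
  max-exists P zero bound (n , pn) | no ¬pb with z≤n ← bound n pn = contradiction pn ¬pb
  max-exists P (suc b) bound (n , pn) | no ¬pb =
    max-exists P b (λ m pm → ≤-pred (≤∧≢⇒< (bound m pm) λ { refl → ¬pb pm })) (n , pn)

  min-exists : (P : Pred ℕ 0ℓ) → ∃ P → ∃ (IsMin P)
  min-exists P (n , pn) = below n n pn ≤-refl
    where
    below : ∀ b n → P n → n ≤ b → ∃ (IsMin P)
    below zero    n pn n≤b = n , pn , λ m _ → ≤-trans n≤b z≤n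
    below (suc b) n pn n≤b with em {∃[ m ] P m × m ≤ b}
    ... | yes (m , pm , m≤b) = below b m pm m≤b
    ... | no none = n , pn , λ m pm → ≤-trans n≤b (≰⇒> (λ m≤b → none (m , pm , m≤b)))

  _∖_ : Subset n → Subset n → Subset n
  X ∖ Y = ⟦ (λ x → x ∈ X × x ∉ Y) ⟧

  comp : GraphOn n → Subset n → Fin n → Subset n
  comp G X x = ⟦ (λ y → y ∈ X × Reach G X x y) ⟧

  module _ (G : GraphOn n) where

    crossing : ∀ {X} (P : Pred (Fin n) 0ℓ) {u v} → Reach G X u v → P u → ¬ P v →
               ∃[ y ] ∃[ z ] P y × ¬ P z × y ∈ X × z ∈ X × E G y z
    crossing P ε pu ¬pv = contradiction pu ¬pv
    crossing P {u} (_◅_ {j = z} (u∈X , z∈X , e) r) pu ¬pv with em {P z}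
    ... | yes pz = crossing P r pz ¬pv
    ... | no ¬pz = u , z , pu , ¬pz , u∈X , z∈X , e

    closed-absorbs : ∀ {C X Y y} → Closed G C X → Y ⊆ X → Conn G Y → y ∈ Y → y ∈ C → Y ⊆ C
    closed-absorbs {C} closed Y⊆X cY y∈Y y∈C {z} z∈Y = by-contradiction λ z∉C →
      let _ , _ , u∈C , v∉C , _ , v∈Y , e = crossing (_∈ C) (cY y∈Y z∈Y) y∈C z∉C
      in v∉C (closed u∈C (Y⊆X v∈Y) e)

    comp-⊆ : ∀ {X x} → comp G X x ⊆ X
    comp-⊆ = proj₁ ∘ ∈⟦⟧⁻

    comp-self : ∀ {X x} → x ∈ X → x ∈ comp G X x
    comp-self x∈X = ∈⟦⟧⁺ (x∈X , ε)

    comp-conn : ∀ {X x} → Conn G (comp G X x)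
    comp-conn {X} {x} = conn-from G x λ y∈ → lift-reach ε (proj₂ (∈⟦⟧⁻ y∈))
      where
      lift-reach : ∀ {y z} → Reach G X x y → Reach G X y z → Reach G (comp G X x) y z
      lift-reach p ε = ε
      lift-reach p (s@(y∈X , z∈X , e) ◅ q) =
        (∈⟦⟧⁺ (y∈X , p) , ∈⟦⟧⁺ (z∈X , p ◅◅ s ◅ ε) , e) ◅ lift-reach (p ◅◅ s ◅ ε) q

    comp-closed : ∀ {X x} → Closed G (comp G X x) X
    comp-closed u∈ v∈X e with ∈⟦⟧⁻ u∈
    ... | u∈X , p = ∈⟦⟧⁺ (v∈X , p ◅◅ (u∈X , v∈X , e) ◅ ε)

    comp-piece : ∀ {X x} → x ∈ X → Piece G X (comp G X x)
    comp-piece x∈X = piece (_ , comp-self x∈X) comp-conn comp-⊆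

    -- A closed piece is a component of the graph induced on `X`, so this is a choice of k distinct
    -- bad components.
    record Family (Bad : Pred (Subset n) 0ℓ) (k : ℕ) (X : Subset n) : Set where
      field
        set      : Fin k → Subset n
        isPiece  : ∀ i → Piece G X (set i)
        closed   : ∀ i → Closed G (set i) X
        bad      : ∀ i → Bad (set i)
        disjoint : ∀ {i j} → i ≢ j → ∀ {x} → x ∈ set i → x ∉ set j

    add : ∀ {Bad k X C} → Piece G X C → Closed G C X → Bad C →
          Family Bad k (X ∖ C) → Family Bad (suc k) X
    add {Bad} {k} {X} {C} pC clC bC F = record
      { set      = λ { zero → C ; (suc i) → F.set i }
      ; isPiece  = λ { zero → pC ; (suc i) → piece-mono (proj₁ ∘ ∈⟦⟧⁻) (F.isPiece i) }
      ; closed   = λ { zero → clC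
                     -- Were the new endpoint in `C`, closedness of `C` along the reversed edge
                     -- would put the old endpoint into `C` too.
                     ; (suc i) u∈ v∈X e → F.closed i u∈
                         (∈⟦⟧⁺ (v∈X , λ v∈C → out i u∈ (clC v∈C (in-X i u∈) (adj-sym G e)))) e }
      ; bad      = λ { zero → bC ; (suc i) → F.bad i }
      ; disjoint = λ { {zero} {zero} i≢j → contradiction refl i≢j
                     ; {zero} {suc j} _ x∈C x∈j → out j x∈j x∈C
                     ; {suc i} {zero} _ x∈i x∈C → out i x∈i x∈C
                     ; {suc i} {suc j} i≢j → F.disjoint (i≢j ∘ cong suc) }
      }
      where
      module F = Family F
      in-X : ∀ i {x} → x ∈ F.set i → x ∈ X
      in-X i x∈ = proj₁ (∈⟦⟧⁻ (Piece.sub (F.isPiece i) x∈))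
      out : ∀ i {x} → x ∈ F.set i → x ∉ C
      out i x∈ = proj₂ (∈⟦⟧⁻ (Piece.sub (F.isPiece i) x∈))

    -- Good components need no deletion; each bad one contributes its own first deleted set. The
    -- recursion peels off bad components one at a time and must run out of them before it has found
    -- k.
    merge : ∀ {d w} k X → (∀ Y → Piece G X Y → Shattered G (suc d) w Y) →
            ¬ Family (λ C → ¬ Shattered G d w C) k X →
            ∃[ S ] length S ≤ k * w × (∀ Y → Piece G X Y → Avoids S Y → Shattered G d w Y)
    merge zero X all none = contradiction
      (record { set = λ () ; isPiece = λ () ; closed = λ () ; bad = λ () ; disjoint = λ { {()} } }) none
    merge {d} {w} (suc k) X all none with em {∃[ Y ] Piece G X Y × ¬ Shattered G d w Y}
    ... | no ¬bad = [] , z≤n , λ Y p _ → by-contradiction λ ¬sh → ¬bad (Y , p , ¬sh)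
    ... | yes (Y , piece (y , y∈Y) cY Y⊆X , badY)
      with all (comp G X y) (comp-piece (Y⊆X y∈Y))
         | merge k (X ∖ comp G X y) (λ Z p → all Z (piece-mono (proj₁ ∘ ∈⟦⟧⁻) p))
             (λ F → none (add (comp-piece (Y⊆X y∈Y)) comp-closed
                -- The whole component of `y` is bad, since it contains the bad piece `Y`.
                (badY ∘ shattered-mono d ≤-refl (closed-absorbs comp-closed Y⊆X cY y∈Y
                    (comp-self (Y⊆X y∈Y)))) F))
    ... | S , S≤ , f | S′ , S′≤ , f′ =
      S ++ S′ , ≤-trans (≤-reflexive (length-++ S)) (+-mono-≤ S≤ S′≤) , g
      where
      g : ∀ Z → Piece G X Z → Avoids (S ++ S′) Z → Shattered G d w Z
      g Z (piece ne@(z , z∈Z) cZ Z⊆X) avoid with em {∃[ u ] u ∈ Z × u ∈ comp G X y}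
      ... | yes (u , u∈Z , u∈C) =
        f Z (piece ne cZ (closed-absorbs comp-closed Z⊆X cZ u∈Z u∈C)) (λ v∈ → avoid v∈ ∘ ∈-++⁺ˡ)
      ... | no Z∩C=∅ =
        f′ Z (piece ne cZ (λ v∈Z → ∈⟦⟧⁺ (Z⊆X v∈Z , λ v∈C → Z∩C=∅ (_ , v∈Z , v∈C))))
            (λ v∈ → avoid v∈ ∘ ∈-++⁺ʳ S)

-- Models of 𝐓 h k

-- `Model G k h X u`: the connected set X contains a model of 𝐓 h k whose
-- root branch set contains u.
data Model {n} (G : GraphOn n) (k : ℕ) : ℕ → Subset n → Fin n → Set where
  leaf : ∀ {X u} → Conn G X → u ∈ X → Model G k 0 X u
  node : ∀ {h X u} R (C : Fin k → Subset n) (c : Fin k → Fin n) →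
         Conn G X → R ⊆ X → Conn G R → u ∈ R →
         (∀ i → C i ⊆ X) → (∀ i {x} → x ∈ C i → x ∉ R) →
         (∀ {i j} → i ≢ j → ∀ {x} → x ∈ C i → x ∉ C j) →
         (∀ i → ∃[ r ] r ∈ R × E G r (c i)) →
         (∀ i → Model G k h (C i) (c i)) →
         Model G k (suc h) X u

model-conn : ∀ {h X u} → Model G k h X u → Conn G X
model-conn (leaf cX _) = cX
model-conn (node _ _ _ cX _ _ _ _ _ _ _ _) = cX

model-root : ∀ {h X u} → Model G k h X u → u ∈ X
model-root (leaf _ u∈X) = u∈X
model-root (node _ _ _ _ R⊆X _ u∈R _ _ _ _ _) = R⊆X u∈R

model-mono : ∀ {h X Y u} → X ⊆ Y → Conn G Y → Model G k h X u → Model G k h Y u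
model-mono X⊆Y cY (leaf _ u∈X) = leaf cY (X⊆Y u∈X)
model-mono X⊆Y cY (node R C c _ R⊆X cR u∈R C⊆X C∩R dis link sub) =
  node R C c cY (X⊆Y ∘ R⊆X) cR u∈R (λ i → X⊆Y ∘ C⊆X i) C∩R dis link sub

model-weaken : ∀ {h X u} → Model G (suc k) h X u → Model G k h X u
model-weaken (leaf cX u∈X) = leaf cX u∈X
model-weaken (node R C c cX R⊆X cR u∈R C⊆X C∩R dis link sub) =
  node R (C ∘ inject₁) (c ∘ inject₁) cX R⊆X cR u∈R (C⊆X ∘ inject₁) (C∩R ∘ inject₁)
    (λ i≢j → dis (i≢j ∘ Fin.inject₁-injective)) (link ∘ inject₁) (model-weaken ∘ sub ∘ inject₁)

module ClassicalModel (em : ExcludedMiddle 0ℓ) where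
  open Classical em

  -- Enlarge the root branch set towards v; on the way it swallows at most
  -- one of the k + 1 child models, and the other k survive.
  reroot : ∀ {h X Z u v} → X ⊆ Z → Conn G Z → v ∈ Z → Model G (suc k) h X u → Model G k h Z v
  reroot X⊆Z cZ v∈Z (leaf _ _) = leaf cZ v∈Z
  reroot {G = G} {k = k} {Z = Z} {u} {v} X⊆Z cZ v∈Z
         (node R C c _ R⊆X cR u∈R C⊆X C∩R dis link sub) =
    detach (enlarge v∈Z (cZ v∈Z (X⊆Z (R⊆X u∈R))))
    where
    Enlarged : Fin _ → Set
    Enlarged v = ∃[ i ] ∃[ R′ ] R ⊆ R′ × R′ ⊆ Z × Conn G R′ × v ∈ R′ ×
                 (∀ j → j ≢ i → ∀ {x} → x ∈ C j → x ∉ R′)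

    enlarge : ∀ {v} → v ∈ Z → Reach G Z v u → Enlarged v
    -- No child has been swallowed yet; the index `zero` is a placeholder.
    enlarge _ ε = zero , R , id , X⊆Z ∘ R⊆X , cR , u∈R , λ j _ → C∩R j
    enlarge {v} v∈Z ((_ , y∈Z , e) ◅ p) with enlarge y∈Z p
    ... | i , R′ , R⊆R′ , R′⊆Z , cR′ , y∈R′ , out with em {∃[ j ] j ≢ i × v ∈ C j}
    -- When `v` lies in another child set `C j`, the enlargement made so far is thrown away:
    -- `R ∪ C j` already contains `v`, and `j` becomes the only child that is lost.
    ... | yes (j , _ , v∈Cj) = j , R ∪ C j , x∈p∪q⁺ ∘ inj₁ , R∪C⊆Z
          , conn-∪ G cR (model-conn (sub j)) (proj₁ (proj₂ (link j))) (model-root (sub j))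
              (proj₂ (proj₂ (link j)))
          , x∈p∪q⁺ (inj₂ v∈Cj) , out′
      where
      R∪C⊆Z : R ∪ C j ⊆ Z
      R∪C⊆Z x∈ with x∈p∪q⁻ R (C j) x∈
      ... | inj₁ x∈R = X⊆Z (R⊆X x∈R)
      ... | inj₂ x∈C = X⊆Z (C⊆X j x∈C)
      out′ : ∀ l → l ≢ j → ∀ {x} → x ∈ C l → x ∉ R ∪ C j
      out′ l l≢j x∈Cl x∈ with x∈p∪q⁻ R (C j) x∈
      ... | inj₁ x∈R = C∩R l x∈Cl x∈R
      ... | inj₂ x∈C = dis l≢j x∈Cl x∈C
    ... | no none = i , R′ ∪ ⁅ v ⁆ , x∈p∪q⁺ ∘ inj₁ ∘ R⊆R′ , R∪v⊆Z
          , conn-∪ G cR′ (conn-⁅⁆ G v) y∈R′ (x∈⁅x⁆ v) (adj-sym G e) , x∈p∪q⁺ (inj₂ (x∈⁅x⁆ v)) , out′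
      where
      R∪v⊆Z : R′ ∪ ⁅ v ⁆ ⊆ Z
      R∪v⊆Z x∈ with x∈p∪q⁻ R′ ⁅ v ⁆ x∈
      ... | inj₁ x∈R = R′⊆Z x∈R
      ... | inj₂ x∈v with refl ← x∈⁅y⁆⇒x≡y v x∈v = v∈Z
      out′ : ∀ l → l ≢ i → ∀ {x} → x ∈ C l → x ∉ R′ ∪ ⁅ v ⁆
      out′ l l≢i x∈Cl x∈ with x∈p∪q⁻ R′ ⁅ v ⁆ x∈
      ... | inj₁ x∈R = out l l≢i x∈Cl x∈R
      ... | inj₂ x∈v with refl ← x∈⁅y⁆⇒x≡y v x∈v = none (l , l≢i , x∈Cl)

    detach : Enlarged v → Model G k _ Z v
    detach (i , R′ , R⊆R′ , R′⊆Z , cR′ , v∈R′ , out) =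
      node R′ (C ∘ punchIn i) (c ∘ punchIn i) cZ R′⊆Z cR′ v∈R′ (λ j → X⊆Z ∘ C⊆X _)
        (λ j → out _ (Fin.punchInᵢ≢i i j))
        (λ j≢l → dis (j≢l ∘ Fin.punchIn-injective i _ _))
        (λ j → let r , r∈R , e = link (punchIn i j) in r , R⊆R′ r∈R , e)
        (λ j → model-weaken (sub (punchIn i j)))

  HasModel : GraphOn n → ℕ → ℕ → Subset n → Set
  HasModel G k h X = ∃[ u ] Model G k h X u

  -- Below a vertex r separating X, fewer than k of the remaining components
  -- contain a model of 𝐓 d (k + 1): k of them together with r, rerooted next
  -- to r, would make up a model of 𝐓 (d + 1) k.
  model-or-shattered : ∀ b d k → ∃[ w ] ∀ {n} (G : GraphOn n) X → Piece G X X →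
                       Shattered G b 1 X → HasModel G k d X ⊎ Shattered G d w X
  model-or-shattered zero    d       k = 0 , λ _ _ _ ()
  model-or-shattered (suc b) zero    k = 0 , λ { G X (piece (u , u∈X) cX _) _ → inj₁ (u , leaf cX u∈X) }
  model-or-shattered (suc b) (suc d) k
    with model-or-shattered b (suc d) k | model-or-shattered b d (suc k)
  -- One deletion for the root `r` and `k * w` for the merged first sets; the further `w` makes the
  -- bound dominate the budget of the levels below and of the cases where no root in `X` is deleted.
  ... | w₁ , same | w₂ , lower = suc (k * w) + w , λ G X pX sh → dichotomy G X pX sh
    where
    w = w₁ + w₂
    w≤ : w ≤ suc (k * w) + w
    w≤ = m≤n+m w (suc (k * w))

    dichotomy : ∀ {n} (G : GraphOn n) X → Piece G X X → Shattered G (suc b) 1 X →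
                HasModel G k (suc d) X ⊎ Shattered G (suc d) (suc (k * w) + w) X
    dichotomy {n} G X pX@(piece neX cX _) (S , S≤1 , f) with em {HasModel G k (suc d) X}
    ... | yes mod = inj₁ mod
    ... | no ¬mod = inj₂ (split S S≤1 f)
      where
      without : ∀ Y → Piece G X Y → Shattered G b 1 Y → Shattered G (suc d) w Y
      without Y p@(piece ne cY Y⊆X) sh with same G Y (piece ne cY id) sh
      ... | inj₁ (u , mod) = contradiction (u , model-mono Y⊆X cX mod) ¬mod
      ... | inj₂ sh′ = shattered-mono {G = G} (suc d) (m≤m+n w₁ w₂) id sh′

      split : ∀ S → length S ≤ 1 → (∀ Y → Piece G X Y → Avoids S Y → Shattered G b 1 Y) →
              Shattered G (suc d) (suc (k * w) + w) X
      split [] _ f = shattered-mono {G = G} (suc d) w≤ id (without X pX (f X pX (λ _ ())))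
      split (r ∷ _ ∷ _) (s≤s ()) f
      split (r ∷ []) _ f with r ∈? X
      ... | no r∉X = shattered-mono {G = G} (suc d) w≤ id
                       (without X pX (f X pX (λ { y∈X (here refl) → r∉X y∈X })))
      ... | yes r∈X
        with merge G {d} {w} k (X ∖ ⁅ r ⁆) (λ Y p →
            without Y (piece-mono (proj₁ ∘ ∈⟦⟧⁻) p) (below Y p)) noFamily
        where
        below : ∀ Y → Piece G (X ∖ ⁅ r ⁆) Y → Shattered G b 1 Y
        below Y p = f Y (piece-mono (proj₁ ∘ ∈⟦⟧⁻) p)
          λ { y∈Y (here refl) → proj₂ (∈⟦⟧⁻ (Piece.sub p y∈Y)) (x∈⁅x⁆ r) }

        noFamily : ¬ Family G (λ C → ¬ Shattered G d w C) k (X ∖ ⁅ r ⁆)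
        noFamily F = ¬mod (r , node ⁅ r ⁆ F.set (λ i → proj₁ (attached i)) cX
            (λ x∈ → subst (_∈ X) (sym (x∈⁅y⁆⇒x≡y r x∈)) r∈X) (conn-⁅⁆ G r) (x∈⁅x⁆ r)
            (λ i → proj₁ ∘ ∈⟦⟧⁻ ∘ Piece.sub (F.isPiece i))
            (λ i → proj₂ ∘ ∈⟦⟧⁻ ∘ Piece.sub (F.isPiece i))
            F.disjoint
            (λ i → r , x∈⁅x⁆ r , proj₂ (proj₂ (attached i)))
            model)
          where
          module F = Family F
          -- `X` is connected, so some edge leads out of the component on the way to `r`; as the
          -- component is closed in `X` without `r`, that edge can only end in `r`.
          attached : ∀ i → ∃[ y ] y ∈ F.set i × E G r y
          attached i with F.isPiece i
          ... | piece (y , y∈) cC C⊆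
            with crossing G (_∈ F.set i) (cX (proj₁ (∈⟦⟧⁻ (C⊆ y∈))) r∈X) y∈
                (λ r∈ → proj₂ (∈⟦⟧⁻ (C⊆ r∈)) (x∈⁅x⁆ r))
          ... | u , v , u∈ , v∉ , _ , v∈X , e with v Fin.≟ r
          ... | yes refl = u , u∈ , adj-sym G e
          ... | no v≢r = contradiction (F.closed i u∈ (∈⟦⟧⁺ (v∈X , v≢r ∘ x∈⁅y⁆⇒x≡y r)) e) v∉
          model : ∀ i → Model G k d (F.set i) (proj₁ (attached i))
          model i with lower G (F.set i) (piece (Piece.inhabited (F.isPiece i))
              (Piece.conn (F.isPiece i)) id) (below _ (F.isPiece i))
          ... | inj₁ (_ , mod) = reroot id (Piece.conn (F.isPiece i)) (proj₁ (proj₂ (attached i))) mod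
          ... | inj₂ sh = contradiction (shattered-mono {G = G} d (m≤n+m w₂ w₁) id sh) (F.bad i)
      ... | S , S≤ , g = r ∷ S , s≤s (≤-trans S≤ (m≤m+n _ _)) ,
        λ Y (piece ne cY Y⊆X) avoid → shattered-mono {G = G} d w≤ id
          (g Y (piece ne cY (λ y∈Y → ∈⟦⟧⁺ (Y⊆X y∈Y , λ y∈r → avoid y∈Y (here (x∈⁅y⁆⇒x≡y r y∈r)))))
               (λ y∈Y → avoid y∈Y ∘ there))

-- Graphs on sets of strings

infix 4 _⊑_

_⊑_ : List A → List A → Set
t ⊑ s = ∃[ w ] t ++ w ≡ s

⊑-refl : {t : List A} → t ⊑ t
⊑-refl {t = t} = [] , ++-identityʳ _

⊑-trans : {t s r : List A} → t ⊑ s → s ⊑ r → t ⊑ r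
⊑-trans {t = t} (w , refl) (w′ , refl) = w ++ w′ , sym (++-assoc t w w′)

⊑-length : {t s : List A} → t ⊑ s → length t ≤ length s
⊑-length {t = t} (w , refl) = subst (length t ≤_) (sym (length-++ t)) (m≤m+n _ _)

⊑-∷ : ∀ {i} {t s : List A} → t ⊑ s → i ∷ t ⊑ i ∷ s
⊑-∷ (w , refl) = w , refl

⊑-∷⁻ : ∀ {i j} {t s : List A} → i ∷ t ⊑ j ∷ s → i ≡ j × t ⊑ s
⊑-∷⁻ (w , refl) = refl , w , refl

⊑-snoc : (t : List A) (i : A) → t ⊑ t ∷ʳ i
⊑-snoc t i = i ∷ [] , refl

snoc-⋢ : (t : List A) {i : A} → ¬ t ∷ʳ i ⊑ t
snoc-⋢ t {i} (w , eq) = m+1+n≢m (length t)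
    (trans (sym (trans (cong length (++-assoc t (i ∷ []) w)) (length-++ t))) (cong length eq))

⊑-snoc⁻ : ∀ (t s : List A) {i} → t ⊑ s ∷ʳ i → t ⊑ s ⊎ t ≡ s ∷ʳ i
⊑-snoc⁻ t s (w , eq) with initLast w
... | []      = inj₂ (trans (sym (++-identityʳ t)) eq)
... | w′ ∷ʳ′ j = inj₁ (w′ , ∷ʳ-injectiveˡ (t ++ w′) s (trans (++-assoc t w′ (j ∷ [])) eq))

⊑-branch : ∀ (t : List A) {i j s} → t ∷ʳ i ⊑ s → t ∷ʳ j ⊑ s → i ≡ j
⊑-branch t {i} {j} (w , refl) (w′ , eq) =
  sym (∷-injectiveˡ (++-cancelˡ t _ _
      (trans (sym (++-assoc t (j ∷ []) w′)) (trans eq (++-assoc t (i ∷ []) w)))))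

_⊑?_ : ∀ (t s : List (Fin k)) → Dec (t ⊑ s)
[]      ⊑? s       = yes (s , refl)
(i ∷ t) ⊑? []      = no λ ()
(i ∷ t) ⊑? (j ∷ s) with i Fin.≟ j | t ⊑? s
... | yes refl | yes t⊑s = yes (⊑-∷ t⊑s)
... | yes refl | no t⋢s  = no (t⋢s ∘ proj₂ ∘ ⊑-∷⁻)
... | no i≢j   | _       = no (i≢j ∘ proj₁ ∘ ⊑-∷⁻)

Comparable : List A → List A → Set
Comparable t s = t ⊑ s ⊎ s ⊑ t

lookup-injective : {xs : List A} → Unique xs → ∀ {i j} → lookup xs i ≡ lookup xs j → i ≡ j
lookup-injective (_ ∷ _)  {zero}  {zero}  _  = refl
lookup-injective (x∉ ∷ _) {zero}  {suc j} eq = contradiction eq (All.lookup x∉ (∈-lookup j))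
lookup-injective (x∉ ∷ _) {suc i} {zero}  eq = contradiction (sym eq) (All.lookup x∉ (∈-lookup i))
lookup-injective (_ ∷ u)  {suc i} {suc j} eq = cong suc (lookup-injective u eq)

T-adjacent⁻ : ∀ (t s : List (Fin k)) → T (adjacent t s) → Child t s ⊎ Child s t
T-adjacent⁻ t s = Sum.map Dec.toWitness Dec.toWitness ∘ Equivalence.to (T-∨ {⌊ child? t s ⌋})

T-adjacent⁺ : ∀ (t s : List (Fin k)) → Child t s ⊎ Child s t → T (adjacent t s)
T-adjacent⁺ t s = Equivalence.from (T-∨ {⌊ child? t s ⌋}) ∘ Sum.map Dec.fromWitness Dec.fromWitness

-- 𝐓 h k is the case `xs = strings h k`.
stringGraph : (xs : List (List (Fin k))) → GraphOn (length xs)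
stringGraph xs = record
  { adj    = λ i j → adjacent (lookup xs i) (lookup xs j)
  ; symm   = λ i j → ∨-comm ⌊ child? (lookup xs i) (lookup xs j) ⌋ _
  ; irrefl = λ i → adjacent-irrefl (lookup xs i)
  }

module _ {R : Rel (Fin n) 0ℓ} where

  source∈ : ∀ {u v} (p : Star R u v) → u List.∈ vertices p
  source∈ ε       = here refl
  source∈ (_ ◅ _) = here refl

  target∈ : ∀ {u v} (p : Star R u v) → v List.∈ vertices p
  target∈ ε       = here refl
  target∈ (_ ◅ p) = there (target∈ p)

-- Used with `P` saying that a vertex is inside, or outside, the cone of strings extending a given
-- one. A tree lets a walk cross the border of a cone in one direction only by stepping into one
-- particular vertex, namely `u`.
walk-invariant : (G : GraphOn n) (P : Pred (Fin n) 0ℓ) (u : Fin n) →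
                 (∀ {x y} → P x → y ≢ u → E G x y → P y) →
                 ∀ {x v} (p : Walk G x v) → ¬ u List.∈ vertices p → P x →
                 ∀ {y} → y List.∈ vertices p → P y
walk-invariant G P u step ε       u∉ px (here refl) = px
walk-invariant G P u step (e ◅ p) u∉ px (here refl) = px
walk-invariant G P u step (e ◅ p) u∉ px (there y∈)  =
  walk-invariant G P u step p (u∉ ∘ there)
    (step px (λ { refl → u∉ (there (source∈ p)) }) e) y∈

-- This covers both the set of all strings of length at most h, which gives a tree, and the set of
-- the non-empty ones, which gives a forest with one tree per first letter.
record Convex (xs : List (List (Fin k))) : Set where
  field
    unique : Unique xs
    convex : ∀ t w i → t List.∈ xs → t ++ (w ∷ʳ i) List.∈ xs → t ++ w List.∈ xs

module StringGraph {k : ℕ} {xs : List (List (Fin k))} (cvx : Convex xs) where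
  open Convex cvx

  H : GraphOn (length xs)
  H = stringGraph xs

  str : Fin (length xs) → List (Fin k)
  str = lookup xs

  position : ∀ {s} → s List.∈ xs → Fin (length xs)
  position = Any.index

  str-position : ∀ {s} (s∈ : s List.∈ xs) → str (position s∈) ≡ s
  str-position = sym ∘ Any.lookup-index

  str-injective : ∀ {i j} → str i ≡ str j → i ≡ j
  str-injective = lookup-injective unique

  E⁻ : ∀ {i j} → E H i j → Child (str i) (str j) ⊎ Child (str j) (str i)
  E⁻ = T-adjacent⁻ _ _

  E⁺ : ∀ {i j} → Child (str i) (str j) ⊎ Child (str j) (str i) → E H i j
  E⁺ {i} {j} = T-adjacent⁺ (str i) (str j)

  -- A step to a child keeps the prefix `t`, and a step to a parent loses it only at `t` itself.
  cone-exit : ∀ {t i j} → E H i j → t ⊑ str i → ¬ t ⊑ str j → Child (str j) t × t ≡ str i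
  cone-exit {t} {i} {j} e t⊑i t⋢j with E⁻ e
  ... | inj₁ (c , eq) = contradiction (⊑-trans t⊑i (subst (str i ⊑_) (sym eq) (⊑-snoc _ c))) t⋢j
  ... | inj₂ (c , eq) with ⊑-snoc⁻ t (str j) (subst (t ⊑_) eq t⊑i)
  ...   | inj₁ t⊑j = contradiction t⊑j t⋢j
  ...   | inj₂ t≡  = (c , t≡) , trans t≡ (sym eq)

  cone-stay : ∀ {t u} → (∀ {j} → Child (str j) t → j ≡ u) →
              ∀ {x y} → t ⊑ str x → y ≢ u → E H x y → t ⊑ str y
  cone-stay {t} parent {x} {y} t⊑x y≢u e with t ⊑? str y
  ... | yes t⊑y = t⊑y
  ... | no t⋢y  = contradiction (parent (proj₁ (cone-exit e t⊑x t⋢y))) y≢u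

  parent-unique : ∀ {t i c} → t ≡ str i ∷ʳ c → ∀ {j} → Child (str j) t → j ≡ i
  parent-unique {i = i} t≡ {j} (c , eq) = str-injective (∷ʳ-injectiveˡ (str j) (str i) (trans (sym eq) t≡))

  outside-stay : ∀ {u x y} → ¬ str u ⊑ str x → y ≢ u → E H x y → ¬ str u ⊑ str y
  outside-stay u⋢x y≢u e u⊑y = y≢u (sym (str-injective (proj₂ (cone-exit (adj-sym H e) u⊑y u⋢x))))

  -- If `x` is a child of `u`, a walk from `x` avoiding `u` stays in the cone of `x`, where `x` is
  -- the only neighbour of `u`. If `x` is the parent of `u`, the walk stays outside the cone of `u`,
  -- and the parent is the only neighbour there. Acyclicity follows, as a cycle through `u` has two
  -- neighbours of `u` on it.
  bridge : ∀ {u x v} → E H u x → (p : Walk H x v) → ¬ u List.∈ vertices p → E H u v → v ≡ x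
  bridge {u} {x} {v} e p u∉p e′ with E⁻ e
  ... | inj₁ (c , x≡) = below (E⁻ e′)
    where
    x⊑v : str x ⊑ str v
    x⊑v = walk-invariant H (λ y → str x ⊑ str y) u (cone-stay (parent-unique x≡)) p u∉p ⊑-refl (target∈ p)
    below : Child (str u) (str v) ⊎ Child (str v) (str u) → v ≡ x
    below (inj₁ (c′ , v≡)) with ⊑-branch (str u) (subst (_⊑ str v) x≡ x⊑v)
        (subst (str u ∷ʳ c′ ⊑_) (sym v≡) ⊑-refl)
    ... | refl = str-injective (trans v≡ (sym x≡))
    below (inj₂ (c′ , u≡)) = contradiction
      (⊑-trans (subst (_⊑ str v) x≡ x⊑v) (subst (str v ⊑_) (sym u≡) (⊑-snoc _ c′))) (snoc-⋢ (str u))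
  ... | inj₂ (c , u≡) = above (E⁻ e′)
    where
    u⋢v : ¬ str u ⊑ str v
    u⋢v = walk-invariant H (λ y → ¬ str u ⊑ str y) u outside-stay p u∉p
            (snoc-⋢ (str x) ∘ subst (_⊑ str x) u≡) (target∈ p)
    above : Child (str u) (str v) ⊎ Child (str v) (str u) → v ≡ x
    above (inj₁ (c′ , v≡)) = contradiction (subst (str u ⊑_) (sym v≡) (⊑-snoc _ c′)) u⋢v
    above (inj₂ ch) = parent-unique u≡ ch

  acyclic : Acyclic H
  acyclic (_◅_ {j = x} e (_◅_ {j = y} e₁ p)) (u∉ ∷ x∉ ∷ _) 2≤ e′ =
    All.lookup x∉ (target∈ p)
      (sym (bridge e (e₁ ◅ p) (λ u∈ → All.lookup u∉ u∈ refl) (adj-sym H e′)))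
  acyclic ε _ ()
  acyclic (e ◅ ε) _ (s≤s ())

  -- The first step cannot go to the parent, which lies outside the cone. The rest of the path never
  -- returns to `u` and so stays in the cone of the child reached; every edge thus adds a letter.
  descend : ∀ {u v} (p : Walk H u v) → IsPath p → (∀ {y} → y List.∈ vertices p → str u ⊑ str y) →
            edges p + length (str u) ≤ length (str v)
  descend ε _ _ = ≤-refl
  descend {u} {v} (_◅_ {j = x} e p) (u∉ ∷ up) above with E⁻ e
  ... | inj₂ (c , u≡) = contradiction (subst (_⊑ str x) u≡ (above (there (source∈ p)))) (snoc-⋢ (str x))
  ... | inj₁ (c , x≡) = ≤-trans
      (≤-reflexive (trans (sym (+-suc (edges p) _))
          (cong (edges p +_) (sym (trans (cong length x≡) (trans (length-++ (str u)) (+-comm _ 1)))))))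
      (descend p up (walk-invariant H (λ y → str x ⊑ str y) u (cone-stay (parent-unique x≡)) p
        (λ u∈ → All.lookup u∉ u∈ refl) ⊑-refl))

  -- The term `length (str r)` matters for the forest, whose roots are the strings of length 1.
  root-descend : ∀ {r v} → (∀ j → ¬ Child (str j) (str r)) → (p : Walk H r v) → IsPath p →
                 edges p + length (str r) ≤ length (str v)
  root-descend {r} root p up = descend p up (stay p ⊑-refl)
    where
    stay : ∀ {x v} (p : Walk H x v) → str r ⊑ str x → ∀ {y} → y List.∈ vertices p → str r ⊑ str y
    stay ε       r⊑x (here refl) = r⊑x
    stay (e ◅ p) r⊑x (here refl) = r⊑x
    stay {x} (_◅_ {j = z} e p) r⊑x (there y∈) with str r ⊑? str z
    ... | yes r⊑z = stay p r⊑z y∈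
    ... | no r⋢z  = contradiction (proj₁ (cone-exit e r⊑x r⋢z)) (root z)

  -- Every extension of `t` is reached from `t` by appending letters one by one, and convexity keeps
  -- the intermediate strings in `xs`. This becomes the connectivity condition of deconstructions.
  cone-conn : ∀ {t} → t List.∈ xs → ConnectedSet H (λ j → t ⊑ str j)
  cone-conn {t} t∈ {i} {j} t⊑i t⊑j =
    reverse (λ (a , b , e) → b , a , adj-sym H e) (down (reverseView (proj₁ t⊑i)) (sym (proj₂ t⊑i)))
    ◅◅ down (reverseView (proj₁ t⊑j)) (sym (proj₂ t⊑j))
    where
    Cone : Fin (length xs) → Fin (length xs) → Set
    Cone = Star (λ x y → t ⊑ str x × t ⊑ str y × E H x y)

    down : ∀ {w} → Reverse w → ∀ {j} → str j ≡ t ++ w → Cone (position t∈) j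
    down [] {j} eq with str-injective {position t∈} {j}
        (trans (str-position t∈) (sym (trans eq (++-identityʳ t))))
    ... | refl = ε
    down (w ∶ rw ∶ʳ c) {j} eq = down rw (str-position w∈) ◅◅
      ((w , sym (str-position w∈)) , (w ∷ʳ c , sym eq) ,
       E⁺ (inj₁ (c , trans eq (trans (sym (++-assoc t w (c ∷ [])))
           (cong (_∷ʳ c) (sym (str-position w∈))))))) ◅ ε
      where
      w∈ : t ++ w List.∈ xs
      w∈ = convex t w c t∈ (subst (List._∈ xs) eq (∈-lookup j))

-- Strings of bounded length

strings-length : ∀ h {s} → s List.∈ strings h k → length s ≤ h
nonEmptyStrings-length : ∀ h {s} → s List.∈ nonEmptyStrings h k → length s ≤ h
strings-length h (here refl) = z≤n
strings-length h (there s∈)  = nonEmptyStrings-length h s∈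
nonEmptyStrings-length {k} (suc h) s∈ with Any.satisfied
    (∈-concatMap⁻ (λ i → map (i ∷_) (strings h k)) {xs = allFin k} s∈)
... | i , s∈i with ∈-map⁻ (i ∷_) s∈i
... | s′ , s′∈ , refl = s≤s (strings-length h s′∈)

[]∉nonEmptyStrings : ∀ h → ¬ [] List.∈ nonEmptyStrings h k
[]∉nonEmptyStrings {k} (suc h) s∈ with Any.satisfied
    (∈-concatMap⁻ (λ i → map (i ∷_) (strings h k)) {xs = allFin k} s∈)
... | i , s∈i with ∈-map⁻ (i ∷_) s∈i
... | _ , _ , ()

∈strings : ∀ h {s : List (Fin k)} → length s ≤ h → s List.∈ strings h k
∈nonEmptyStrings : ∀ h {i} {s : List (Fin k)} → length s ≤ h → i ∷ s List.∈ nonEmptyStrings (suc h) k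
∈strings h {[]} _ = here refl
∈strings (suc h) {i ∷ s} (s≤s s≤h) = there (∈nonEmptyStrings h s≤h)
∈nonEmptyStrings {k} h {i} s≤h =
  ∈-concatMap⁺ (λ i → map (i ∷_) (strings h k))
      (Any.map (λ { refl → ∈-map⁺ (i ∷_) (∈strings h s≤h) }) (∈-allFin i))

strings-unique : ∀ h → Unique (strings h k)
nonEmptyStrings-unique : ∀ h → Unique (nonEmptyStrings h k)
strings-unique h = All.tabulate (λ { s∈ refl → []∉nonEmptyStrings h s∈ }) ∷ nonEmptyStrings-unique h
nonEmptyStrings-unique zero = AllPairs.[]
nonEmptyStrings-unique {k} (suc h) = Unique.concat⁺
  (All.map⁺ (All.tabulate λ _ → Unique.map⁺ ∷-injectiveʳ (strings-unique h)))
  (AllPairs.map⁺ (AllPairs.map disjoint (Unique.allFin⁺ k)))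
  where
  disjoint : ∀ {i j} → i ≢ j → ∀ {s} →
      ¬ (s List.∈ map (i ∷_) (strings h k) × s List.∈ map (j ∷_) (strings h k))
  disjoint {i} {j} i≢j (s∈i , s∈j) with ∈-map⁻ (i ∷_) s∈i | ∈-map⁻ (j ∷_) s∈j
  ... | _ , _ , refl | _ , _ , eq = i≢j (∷-injectiveˡ eq)

init-length : ∀ (t w : List A) {i} → length (t ++ w) ≤ length (t ++ (w ∷ʳ i))
init-length t w {i} = subst (length (t ++ w) ≤_) (cong length (++-assoc t w (i ∷ [])))
    (⊑-length (⊑-snoc (t ++ w) i))

strings-convex : ∀ h → Convex (strings h k)
strings-convex h = record
  { unique = strings-unique h
  ; convex = λ t w i _ s∈ → ∈strings h (≤-trans (init-length t w) (strings-length h s∈))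
  }

nonEmptyStrings-convex : ∀ h → Convex (nonEmptyStrings (suc h) k)
nonEmptyStrings-convex {k} h = record { unique = nonEmptyStrings-unique (suc h) ; convex = convex }
  where
  convex : ∀ t w i → t List.∈ nonEmptyStrings (suc h) k → t ++ (w ∷ʳ i) List.∈ nonEmptyStrings (suc h) k →
           t ++ w List.∈ nonEmptyStrings (suc h) k
  convex []      w i t∈ _  = contradiction t∈ ([]∉nonEmptyStrings (suc h))
  convex (c ∷ t) w i _  s∈ with nonEmptyStrings-length (suc h) s∈
  ... | s≤s le = ∈nonEmptyStrings h (≤-trans (init-length t w) le)

-- Paths, rootings and heights

module _ {R : Rel (Fin n) 0ℓ} where

  -- The start is left out, so that the path from a root to itself gives the empty string and
  -- ancestors give prefixes.
  steps : ∀ {u v} → Star R u v → List (Fin n)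
  steps ε                 = []
  steps (_◅_ {j = y} _ p) = y ∷ steps p

  steps-length : ∀ {u v} (p : Star R u v) → length (steps p) ≡ edges p
  steps-length ε       = refl
  steps-length (_ ◅ p) = cong suc (steps-length p)

  vertices-steps : ∀ {u v} (p : Star R u v) → vertices p ≡ u ∷ steps p
  vertices-steps ε       = refl
  vertices-steps (_ ◅ p) = cong (_ ∷_) (vertices-steps p)

  steps-∷ʳ : ∀ {u v w} (p : Star R u v) (e : R v w) → steps (p ◅◅ e ◅ ε) ≡ steps p ∷ʳ w
  steps-∷ʳ ε       e = refl
  steps-∷ʳ (_ ◅ p) e = cong (_ ∷_) (steps-∷ʳ p e)

  steps-injective : ∀ {r u v} (p : Star R r u) (q : Star R r v) → steps p ≡ steps q → u ≡ v
  steps-injective ε       ε       _  = refl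
  steps-injective (_ ◅ p) (_ ◅ q) eq with ∷-injectiveˡ eq
  ... | refl = steps-injective p q (∷-injectiveʳ eq)

  record Split {u v} (p : Star R u v) (x : Fin n) : Set where
    field
      before       : Star R u x
      after        : Star R x v
      before-path  : IsPath before
      after-path   : IsPath after
      before-sub   : ∀ {y} → y List.∈ vertices before → y List.∈ vertices p
      after-sub    : ∀ {y} → y List.∈ vertices after → y List.∈ vertices p
      steps-split  : steps p ≡ steps before ++ steps after

  split : ∀ {u v x} (p : Star R u v) → IsPath p → x List.∈ vertices p → Split p x
  split ε up (here refl) = record
    { before = ε ; after = ε ; before-path = up ; after-path = up
    ; before-sub = id ; after-sub = id ; steps-split = refl }
  split p@(_ ◅ _) up (here refl) = record
    { before = ε ; after = p ; before-path = All.[] ∷ AllPairs.[] ; after-path = up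
    ; before-sub = λ { (here refl) → here refl } ; after-sub = id ; steps-split = refl }
  split (e ◅ p) (u∉ ∷ up) (there x∈) = record
    { before = e ◅ S.before ; after = S.after
    ; before-path = All.tabulate (λ y∈ → All.lookup u∉ (S.before-sub y∈)) ∷ S.before-path
    ; after-path = S.after-path
    ; before-sub = λ { (here refl) → here refl ; (there y∈) → there (S.before-sub y∈) }
    ; after-sub = there ∘ S.after-sub
    ; steps-split = cong (_ ∷_) S.steps-split }
    where module S = Split (split p up x∈)

  -- Loop erasure: if the shortened tail revisits `u`, only its part from `u` on is kept.
  shorten : ∀ {u v} (p : Star R u v) →
            Σ[ q ∈ Star R u v ] IsPath q × (∀ {y} → y List.∈ vertices q → y List.∈ vertices p)
  shorten ε = ε , All.[] ∷ AllPairs.[] , id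
  shorten {u} (e ◅ p) with shorten p
  ... | q , uq , q⊆p with Any.any? (u Fin.≟_) (vertices q)
  ... | yes u∈ = S.after , S.after-path , there ∘ q⊆p ∘ S.after-sub
    where module S = Split (split q uq u∈)
  ... | no u∉ = e ◅ q , All.tabulate (λ { y∈ refl → u∉ y∈ }) ∷ uq
              , λ { (here refl) → here refl ; (there y∈) → there (q⊆p y∈) }

  ∈-◅◅ : ∀ {u v w y} (p : Star R u v) (q : Star R v w) → y List.∈ vertices (p ◅◅ q) →
         y List.∈ vertices p ⊎ y List.∈ vertices q
  ∈-◅◅ ε       q y∈         = inj₂ y∈
  ∈-◅◅ (_ ◅ p) q (here y≡)  = inj₁ (here y≡)
  ∈-◅◅ (_ ◅ p) q (there y∈) with ∈-◅◅ p q y∈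
  ... | inj₁ y∈p = inj₁ (there y∈p)
  ... | inj₂ y∈q = inj₂ y∈q

path-edges≤ : {R : Rel (Fin n) 0ℓ} → ∀ {u v} (p : Star R u v) → IsPath p → edges p ≤ n
path-edges≤ {n = n} p up =
  ≤-trans (n≤1+n _) (subst (_≤ n) (trans (cong length (vertices-steps p)) (cong suc (steps-length p)))
                           (Fin.injective⇒≤ (lookup-injective up)))

module _ (G : GraphOn n) where

  walk-reverse : ∀ {u v} (p : Walk G u v) →
                 Σ[ q ∈ Walk G v u ] (∀ {y} → y List.∈ vertices q → y List.∈ vertices p)
  walk-reverse ε = ε , id
  walk-reverse (e ◅ p) with walk-reverse p
  ... | q , q⊆p = q ◅◅ adj-sym G e ◅ ε
      , λ y∈ → [ there ∘ q⊆p
               , (λ { (here refl) → there (source∈ p) ; (there (here refl)) → here refl }) ]′ (∈-◅◅ q _ y∈)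

  reach-walk : ∀ {X u v} → u ∈ X → Reach G X u v →
               Σ[ p ∈ Walk G u v ] (∀ {y} → y List.∈ vertices p → y ∈ X)
  reach-walk u∈X ε = ε , λ { (here refl) → u∈X }
  reach-walk u∈X ((_ , y∈X , e) ◅ r) with reach-walk y∈X r
  ... | p , p⊆X = e ◅ p , λ { (here refl) → u∈X ; (there y∈) → p⊆X y∈ }

  reach-path : ∀ {X u v} → u ∈ X → Reach G X u v → Σ[ p ∈ Walk G u v ] IsPath p
  reach-path u∈X r with shorten (proj₁ (reach-walk u∈X r))
  ... | p , up , _ = p , up

  walk-reach : ∀ {u v} → Walk G u v → Reach G full u v
  walk-reach = Star.map λ e → ∈⊤ , ∈⊤ , e

  module _ (acyclic : Acyclic G) where

    -- Two paths with different second vertices `x` and `y` would close a cycle: their remainders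
    -- contain a path from `x` to `y` avoiding `u`, and `u` is adjacent to both.
    path-unique : ∀ {u v} (p q : Walk G u v) → IsPath p → IsPath q → steps p ≡ steps q
    path-unique ε       ε       _        _        = refl
    path-unique ε       (_ ◅ q) _        (u∉ ∷ _) = contradiction refl (All.lookup u∉ (target∈ q))
    path-unique (_ ◅ p) ε       (u∉ ∷ _) _        = contradiction refl (All.lookup u∉ (target∈ p))
    path-unique {u} (_◅_ {j = x} e p) (_◅_ {j = y} e′ q) (u∉p ∷ up) (u∉q ∷ uq) with x Fin.≟ y
    ... | yes refl = cong (x ∷_) (path-unique p q up uq)
    ... | no x≢y with walk-reverse q
    ... | q′ , q′⊆q with shorten (p ◅◅ q′)
    ... | w , uw , w⊆ = contradiction (adj-sym G e′)
          (acyclic (e ◅ w) (All.tabulate u∉w ∷ uw) (s≤s (nonTrivial w)))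
      where
      u∉w : ∀ {z} → z List.∈ vertices w → u ≢ z
      u∉w z∈ with ∈-◅◅ p q′ (w⊆ z∈)
      ... | inj₁ z∈p = All.lookup u∉p z∈p
      ... | inj₂ z∈q = All.lookup u∉q (q′⊆q z∈q)
      nonTrivial : (w : Walk G x y) → 1 ≤ edges w
      nonTrivial ε       = contradiction refl x≢y
      nonTrivial (_ ◅ _) = s≤s z≤n

    ancestor-⊑ : ∀ {r u v} (p : Walk G r u) (q : Walk G r v) → IsPath p → IsPath q →
                 u List.∈ vertices q → steps p ⊑ steps q
    ancestor-⊑ p q up uq u∈ = steps S.after ,
      trans (cong (_++ steps S.after) (path-unique p S.before up S.before-path)) (sym S.steps-split)
      where module S = Split (split q uq u∈)

    private
      extend : ∀ {r u v} (p : Walk G r u) (q : Walk G r v) → IsPath p → IsPath q → E G u v →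
               ¬ v List.∈ vertices p → steps q ≡ steps p ∷ʳ v
      extend {v = v} p q up uq e v∉p =
        trans (path-unique q (p ◅◅ e ◅ ε) uq (snoc-path p up e v∉p)) (steps-∷ʳ p e)
        where
        snoc-path : ∀ {r u v} (p : Walk G r u) → IsPath p → (e : E G u v) → ¬ v List.∈ vertices p →
            IsPath (p ◅◅ e ◅ ε)
        snoc-path ε up e v∉ = ((λ { refl → v∉ (here refl) }) All.∷ All.[]) ∷ (All.[] ∷ AllPairs.[])
        snoc-path (e₁ ◅ p) (u∉ ∷ up) e v∉ =
          All.tabulate (λ y∈ → [ All.lookup u∉ , (λ { (here refl) → All.lookup u∉ (target∈ p)
                                                    ; (there (here refl)) refl → v∉ (here refl) }) ]′
                                (∈-◅◅ p (e ◅ ε) y∈))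
          ∷ snoc-path p up e (v∉ ∘ there)

    -- If `v` is not on `p`, appending the edge to `p` gives the unique path to `v`. Otherwise the
    -- part of `p` after `v` joins two adjacent vertices and, without cycles, is a single edge.
    edge-steps : ∀ {r u v} (p : Walk G r u) (q : Walk G r v) → IsPath p → IsPath q → E G u v →
                 steps q ≡ steps p ∷ʳ v ⊎ steps p ≡ steps q ∷ʳ u
    edge-steps {u = u} {v} p q up uq e with Any.any? (v Fin.≟_) (vertices p)
    ... | no v∉  = inj₁ (extend p q up uq e v∉)
    ... | yes v∈ = inj₂ (trans S.steps-split
          (trans (cong (_++ steps S.after) (path-unique S.before q S.before-path uq))
                                                    (cong (steps q ++_) (single S.after S.after-path))))
      where
      module S = Split (split p up v∈)
      single : (w : Walk G v u) → IsPath w → steps w ≡ u ∷ []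
      single ε _ = contradiction e (¬adj-refl G)
      single (_ ◅ ε) _ = refl
      single w@(_ ◅ _ ◅ _) uw = contradiction e (acyclic w uw (s≤s (s≤s z≤n)))

PathBound : GraphOn n → Fin n → ℕ → Set
PathBound G r d = ∀ {v} (p : Walk G r v) → IsPath p → edges p ≤ d

-- A common form for trees and forests of height at most `d`. The labels turn each component into a
-- tree of strings over the vertices.
record Rooting (d : ℕ) (G : GraphOn n) : Set where
  field
    acyclic : Acyclic G
    root    : Fin n → Fin n
    same    : ∀ {u v} → E G u v → root u ≡ root v
    path    : ∀ v → Walk G (root v) v
    isPath  : ∀ v → IsPath (path v)
    short   : ∀ v → edges (path v) ≤ d

  label : Fin n → List (Fin n)
  label v = steps (path v)

  label-edge : ∀ {u v} → E G u v → label v ≡ label u ∷ʳ v ⊎ label u ≡ label v ∷ʳ u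
  label-edge {u} {v} e = go (same e) (path u) (path v) (isPath u) (isPath v)
    where
    go : ∀ {r r′} → r ≡ r′ → (p : Walk G r u) (q : Walk G r′ v) → IsPath p → IsPath q →
         steps q ≡ steps p ∷ʳ v ⊎ steps p ≡ steps q ∷ʳ u
    go refl p q up uq = edge-steps G acyclic p q up uq e

  label-injective : ∀ {u v} → root u ≡ root v → label u ≡ label v → u ≡ v
  label-injective {u} {v} = go (path u) (path v)
    where
    go : ∀ {r r′} (p : Walk G r u) (q : Walk G r′ v) → r ≡ r′ → steps p ≡ steps q → u ≡ v
    go p q refl = steps-injective p q

module Induced (G : GraphOn n) (C : Subset n) where

  emb : Fin (length (elements C)) → Fin n
  emb = lookup (elements C)

  emb∈ : ∀ i → emb i ∈ C
  emb∈ i = proj₂ (∈-filter⁻ (_∈? C) {xs = allFin n} (∈-lookup i))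

  emb-injective : ∀ {i j} → emb i ≡ emb j → i ≡ j
  emb-injective = lookup-injective (Unique.filter⁺ (_∈? C) (Unique.allFin⁺ n))

  private
    listed : ∀ {x} → x ∈ C → x List.∈ elements C
    listed x∈C = ∈-filter⁺ (_∈? C) (∈-allFin _) x∈C

  pos : ∀ {x} → x ∈ C → Fin (length (elements C))
  pos x∈C = Any.index (listed x∈C)

  emb-pos : ∀ {x} (x∈C : x ∈ C) → emb (pos x∈C) ≡ x
  emb-pos x∈C = sym (Any.lookup-index (listed x∈C))

  pathBound-induced : ∀ {d} i → PathBound G (emb i) d → PathBound (induced G C) i d
  pathBound-induced i bound p up =
    subst (_≤ _) (edges-gmap p) (bound (Star.gmap emb id p)
      (subst Unique (sym (vertices-gmap p)) (Unique.map⁺ emb-injective up)))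
    where
    vertices-gmap : ∀ {i j} (p : Walk (induced G C) i j) →
        vertices {R = E G} (Star.gmap emb id p) ≡ map emb (vertices p)
    vertices-gmap ε       = refl
    vertices-gmap (_ ◅ p) = cong (_ ∷_) (vertices-gmap p)
    edges-gmap : ∀ {i j} (p : Walk (induced G C) i j) → edges {R = E G} (Star.gmap emb id p) ≡ edges p
    edges-gmap ε       = refl
    edges-gmap (_ ◅ p) = cong suc (edges-gmap p)

  pathBound-closed : ∀ {d} i → Closed G C full → PathBound (induced G C) i d → PathBound G (emb i) d
  pathBound-closed {d} i closed bound p up with lift-path i refl p
    where
    lift-path : ∀ {u v} i → emb i ≡ u → (p : Walk G u v) →
                ∃[ j ] Σ[ q ∈ Walk (induced G C) i j ] vertices p ≡ map emb (vertices q) × edges p ≡ edges q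
    lift-path i refl ε = i , ε , refl , refl
    lift-path i refl (_◅_ {j = y} e p) with closed (emb∈ i) ∈⊤ e
    ... | y∈C with lift-path (pos y∈C) (emb-pos y∈C) p
    ... | j , q , vs , es = j , subst (E G (emb i)) (sym (emb-pos y∈C)) e ◅ q , cong (emb i ∷_) vs ,
          cong suc es
  ... | j , q , vs , es = subst (_≤ d) (sym es) (bound q (Unique.map⁻ (subst Unique vs up)))

module ClassicalHeight (em : ExcludedMiddle 0ℓ) where
  open Classical em

  rootedHeight : (G : GraphOn n) (r : Fin n) → ∀ {d} → PathBound G r d → ∃[ l ] RootedHeight G r l × l ≤ d
  rootedHeight G r {d} bound = proj₁ height , proj₂ height , below (proj₁ (proj₂ height))
    where
    P : Pred ℕ 0ℓ
    P l = ∃[ v ] Σ[ p ∈ Walk G r v ] IsPath p × edges p ≡ l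
    below : ∀ {l} → P l → l ≤ d
    below (_ , p , up , refl) = bound p up
    height : ∃ (IsMax P)
    height = max-exists P d (λ _ → below) (0 , r , ε , All.[] ∷ AllPairs.[] , refl)

  treeHeight : (G : GraphOn n) (r : Fin n) → ∀ {d} → PathBound G r d → ∃[ l ] TreeHeight G l × l ≤ d
  treeHeight G r bound with rootedHeight G r bound
  ... | l , rh , l≤d with min-exists (λ l → ∃[ r ] RootedHeight G r l) (l , r , rh)
  ... | h , th = h , th , ≤-trans (proj₂ th l (r , rh)) l≤d

  least : (P : Pred (Fin n) 0ℓ) → ∃ P → ∃[ x ] P x × (∀ y → P y → toℕ x ≤ toℕ y)
  least P (x , px) with min-exists (λ m → ∃[ y ] toℕ y ≡ m × P y) (toℕ x , x , refl , px)
  ... | m , (y , refl , py) , min = y , py , λ z pz → min (toℕ z) (z , refl , pz)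

  module Representative (G : GraphOn n) (X : Subset n) where

    private
      rep′ : ∀ x → ∃[ y ] Reach G X x y × (∀ z → Reach G X x z → toℕ y ≤ toℕ z)
      rep′ x = least (Reach G X x) (x , ε)

    -- The least reachable vertex is chosen, so that connected vertices get equal representatives
    -- and choices can be made once per component.
    rep : Fin n → Fin n
    rep x = proj₁ (rep′ x)

    reach-rep : ∀ x → Reach G X x (rep x)
    reach-rep x = proj₁ (proj₂ (rep′ x))

    rep-cong : ∀ {x y} → Reach G X x y → rep x ≡ rep y
    rep-cong {x} {y} p = Fin.toℕ-injective (≤-antisym
      (proj₂ (proj₂ (rep′ x)) (rep y) (p ◅◅ reach-rep y))
      (proj₂ (proj₂ (rep′ y)) (rep x) (reach-sym G p ◅◅ reach-rep x)))

    rep∈ : ∀ {x} → x ∈ X → rep x ∈ X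
    rep∈ {x} x∈X = end x∈X (reach-rep x)
      where
      end : ∀ {u v} → u ∈ X → Reach G X u v → v ∈ X
      end u∈X ε = u∈X
      end _ ((_ , y∈X , _) ◅ p) = end y∈X p

  comp-component : (G : GraphOn n) (v : Fin n) → Component G (comp G full v)
  comp-component G v = (v , comp-self G ∈⊤) , comp-conn G ,
    λ D cD C⊆D → closed-absorbs G (comp-closed G) (λ _ → ∈⊤) cD (C⊆D (comp-self G ∈⊤)) (comp-self G ∈⊤)

  component-reach : (G : GraphOn n) → ∀ {C u v} → Component G C → u ∈ C → Reach G full u v → v ∈ C
  component-reach G {C} {u} (_ , cC , max) u∈C p =
    max (comp G full u) (comp-conn G) (λ x∈C → ∈⟦⟧⁺ (∈⊤ , reach-mono G (λ _ → ∈⊤) (cC u∈C x∈C)))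
        (∈⟦⟧⁺ (∈⊤ , p))

  forestHeight : (G : GraphOn n) → ∀ {d} → Fin n → (∀ v → ∃[ r ] Reach G full v r × PathBound G r d) →
                 ∃[ h ] ForestHeight G h × h ≤ d
  forestHeight {n} G {d} v₀ rooted = proj₁ height , proj₂ height , below (proj₁ (proj₂ height))
    where
    P : Pred ℕ 0ℓ
    P l = ∃[ C ] Component G C × TreeHeight (induced G C) l

    rootOf : ∀ {C} → Component G C → ∃[ i ] PathBound (induced G C) i d
    rootOf {C} comp@((v , v∈C) , _) with rooted v
    ... | r , v⇝r , bound = pos r∈C , pathBound-induced (pos r∈C)
          (subst (λ r → PathBound G r d) (sym (emb-pos r∈C)) bound)
      where
      open Induced G C
      r∈C : r ∈ C
      r∈C = component-reach G comp v∈C v⇝r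

    below : ∀ {l} → P l → l ≤ d
    below (C , comp , _ , min) =
      let i , bound = rootOf comp
          l , rh , l≤d = rootedHeight (induced G C) i bound
      in ≤-trans (min l (i , rh)) l≤d

    inhabited : ∀ {C} → Component G C → ∃ P
    inhabited {C} comp =
      let i , bound = rootOf comp
          l , th , _ = treeHeight (induced G C) i bound
      in l , C , comp , th

    height : ∃ (IsMax P)
    height = max-exists P d (λ _ → below) (inhabited (comp-component G v₀))

  connected-path : (G : GraphOn n) → Connected G → ∀ u v → Σ[ p ∈ Walk G u v ] IsPath p
  connected-path G c u v with shorten (Star.map (λ (_ , _ , e) → e) (c {u} {v} tt tt))
  ... | p , up , _ = p , up

  tree-rooting : (G : GraphOn n) → Tree G → ∀ {r d} → PathBound G r d → Rooting d G
  tree-rooting G (conn , acyclic) {r} bound = record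
    { acyclic = acyclic
    ; root    = λ _ → r
    ; same    = λ _ → refl
    ; path    = λ v → proj₁ (connected-path G conn r v)
    ; isPath  = λ v → proj₂ (connected-path G conn r v)
    ; short   = λ v → bound (proj₁ (connected-path G conn r v)) (proj₂ (connected-path G conn r v))
    }

  𝒯-pathBound : ∀ {d} G → 𝒯 d G → ∃[ r ] PathBound (graph G) r d
  𝒯-pathBound G (_ , _ , ((r , _ , max) , _) , h≤d) = r , λ p up →
      ≤-trans (max (edges p) (_ , p , up , refl)) h≤d

  rooting : (G : GraphOn n) → Acyclic G → ∀ {d} → (∀ v → ∃[ r ] Reach G full v r × PathBound G r d) →
      Rooting d G
  rooting {n} G acyclic {d} rooted = record
    { acyclic = acyclic
    -- The root supplied for `v` may vary within a component; passing to the representative makes it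
    -- constant there.
    ; root    = λ v → rootOf (rep v)
    ; same    = λ e → cong rootOf (rep-cong ((∈⊤ , ∈⊤ , e) ◅ ε))
    ; path    = λ v → proj₁ (root-path v)
    ; isPath  = λ v → proj₂ (root-path v)
    ; short   = λ v → proj₂ (proj₂ (rooted (rep v))) (proj₁ (root-path v)) (proj₂ (root-path v))
    }
    where
    open Representative G full
    rootOf : Fin n → Fin n
    rootOf v = proj₁ (rooted v)
    root-path : ∀ v → Σ[ p ∈ Walk G (rootOf (rep v)) v ] IsPath p
    root-path v = reach-path G ∈⊤ (reach-sym G (reach-rep v ◅◅ proj₁ (proj₂ (rooted (rep v)))))

  ℱ-rooting : ∀ {d} G → ℱ d G → Rooting d (graph G)
  ℱ-rooting {d} G (acyclic , h , (_ , max) , h≤d) = rooting H acyclic rooted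
    where
    H = graph G
    rooted : ∀ v → ∃[ r ] Reach H full v r × PathBound H r d
    rooted v = rootIn (comp-component H v) (comp-closed H) (λ i → proj₂ (∈⟦⟧⁻ (Induced.emb∈ H _ i)))
      where
      rootIn : ∀ {C} → Component H C → Closed H C full → (∀ i → Reach H full v (Induced.emb H C i)) →
               ∃[ r ] Reach H full v r × PathBound H r d
      rootIn {C} comp@((x , x∈C) , _) closed reach =
        -- The number of vertices is a crude bound on path lengths that makes the height of the
        -- component exist; the bound `d` then comes from the forest height.
        bounded (treeHeight (induced H C) (Induced.pos H C x∈C) (λ p up → path-edges≤ p up))
        where
        bounded : ∀ {b} → ∃[ l ] TreeHeight (induced H C) l × l ≤ b →
            ∃[ r ] Reach H full v r × PathBound H r d
        bounded (l , th@((i , _ , rmax) , _) , _) =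
          Induced.emb H C i , reach i ,
          Induced.pathBound-closed H C i closed
            (λ p up → ≤-trans (rmax (edges p) (_ , p , up , refl)) (≤-trans (max l (C , comp , th)) h≤d))

-- Labellings and deconstructions

∷-view : (t : List A) → t ≢ [] → ∃[ i ] ∃[ s ] t ≡ i ∷ s
∷-view []      t≢[] = contradiction refl t≢[]
∷-view (i ∷ s) _    = i , s , refl

-- t x is the topmost node whose bag contains x, in a deconstruction over a
-- tree of strings: the bag of s is { x ∣ t x ⊑ s }.
record Labelling (G : GraphOn n) (d w : ℕ) (X : Subset n) (t : Fin n → List A) : Set where
  field
    short      : ∀ {x} → x ∈ X → length (t x) < d
    comparable : ∀ {x y} → x ∈ X → y ∈ X → E G x y → Comparable (t x) (t y)
    fibre      : ∀ s → ∃[ F ] length F ≤ w × (∀ {x} → x ∈ X → t x ≡ s → x List.∈ F)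

-- A string of length l has l + 1 prefixes, and each contributes at most `w` vertices. This bounds
-- the bags.
prefix-fibres : (F : List A → List (Fin n)) → ∀ {w} → (∀ s → length (F s) ≤ w) → ∀ s →
                ∃[ L ] length L ≤ suc (length s) * w × (∀ {r x} → r ⊑ s → x List.∈ F r → x List.∈ L)
prefix-fibres F {w} F≤ [] = F [] , ≤-trans (F≤ []) (m≤m+n w 0) , λ { {[]} _ x∈ → x∈ ; {_ ∷ _} (_ , ()) _ }
prefix-fibres F {w} F≤ (i ∷ s) with prefix-fibres (F ∘ (i ∷_)) (F≤ ∘ (i ∷_)) s
... | L , L≤ , covers = F [] ++ L , ≤-trans (≤-reflexive (length-++ (F []))) (+-mono-≤ (F≤ []) L≤)
    , λ { {[]} _ x∈ → ∈-++⁺ˡ x∈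
        ; {_ ∷ _} r⊑ x∈ → ∈-++⁺ʳ (F []) (go r⊑ x∈) }
  where
  go : ∀ {j r x} → j ∷ r ⊑ i ∷ s → x List.∈ F (j ∷ r) → x List.∈ L
  go r⊑ x∈ with ⊑-∷⁻ r⊑
  ... | refl , r⊑s = covers r⊑s x∈

strings-total : ∀ (t s : List (Fin 1)) → Comparable t s
strings-total []         s          = inj₁ (s , refl)
strings-total (i ∷ t)    []         = inj₂ (i ∷ t , refl)
strings-total (zero ∷ t) (zero ∷ s) = Sum.map ⊑-∷ ⊑-∷ (strings-total t s)

module ClassicalLabel (em : ExcludedMiddle 0ℓ) where
  open Classical em
  open ClassicalHeight em

  -- By injectivity at most one vertex has the empty label, and it is deleted. In a connected piece
  -- of the rest all labels share their first letter, because non-empty comparable labels do and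
  -- labels of neighbours are comparable; that letter is dropped and the argument repeated.
  labels-shattered : (G : GraphOn n) → ∀ d (t : Fin n → List A) X → Nonempty X →
                     (∀ {x} → x ∈ X → length (t x) < d) →
                     (∀ {x y} → x ∈ X → y ∈ X → t x ≡ t y → x ≡ y) →
                     (∀ {x y} → x ∈ X → y ∈ X → E G x y → Comparable (t x) (t y)) →
                     Shattered G d 1 X
  labels-below : (G : GraphOn n) → ∀ d (t : Fin n → List A) X →
               (∀ {x} → x ∈ X → length (t x) < suc d) →
               (∀ {x y} → x ∈ X → y ∈ X → t x ≡ t y → x ≡ y) →
               (∀ {x y} → x ∈ X → y ∈ X → E G x y → Comparable (t x) (t y)) →
               ∀ Y → Piece G X Y → (∀ {y} → y ∈ Y → t y ≢ []) → Shattered G d 1 Y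
  labels-shattered G zero    t X (x , x∈X) short inj cmp with short x∈X
  ... | ()
  labels-shattered G (suc d) t X _ short inj cmp with em {∃[ x ] x ∈ X × t x ≡ []}
  ... | yes (x , x∈X , tx≡) = x ∷ [] , ≤-refl , λ Y p avoid →
          labels-below G d t X short inj cmp Y p
            (λ y∈Y ty≡ → avoid y∈Y (here (inj (Piece.sub p y∈Y) x∈X (trans ty≡ (sym tx≡)))))
  ... | no none = [] , z≤n , λ Y p _ →
          labels-below G d t X short inj cmp Y p (λ y∈Y ty≡ → none (_ , Piece.sub p y∈Y , ty≡))

  labels-below G d t X short inj cmp Y (piece (y₀ , y₀∈) cY Y⊆X) ty≢ with ∷-view (t y₀) (ty≢ y₀∈)
  ... | i , s₀ , ty₀ = labels-shattered G d (drop 1 ∘ t) Y (y₀ , y₀∈)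
      (λ y∈ → ≤-pred (subst (λ r → length r < suc d) (tail≡ y∈) (short (Y⊆X y∈))))
      (λ x∈ y∈ eq → inj (Y⊆X x∈) (Y⊆X y∈) (trans (tail≡ x∈) (trans (cong (i ∷_) eq) (sym (tail≡ y∈)))))
      (λ x∈ y∈ e → Sum.map (proj₂ ∘ ⊑-∷⁻) (proj₂ ∘ ⊑-∷⁻)
                     (subst₂ Comparable (tail≡ x∈) (tail≡ y∈) (cmp (Y⊆X x∈) (Y⊆X y∈) e)))
    where
    starts : ∀ {y} → y ∈ Y → ∃[ s ] t y ≡ i ∷ s
    starts y∈ = by-contradiction λ ¬st →
      let u , v , (s , tu≡) , ¬tv , u∈ , v∈ , e =
              crossing G (λ y → ∃[ s ] t y ≡ i ∷ s) (cY y₀∈ y∈) (s₀ , ty₀) ¬st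
          j , s′ , tv≡ = ∷-view (t v) (ty≢ v∈)
          c = subst₂ Comparable tu≡ tv≡ (cmp (Y⊆X u∈) (Y⊆X v∈) e)
      in ¬tv (s′ , trans tv≡ (cong (_∷ s′) ([ sym ∘ proj₁ ∘ ⊑-∷⁻ , proj₁ ∘ ⊑-∷⁻ ]′ c)))
    tail≡ : ∀ {y} → y ∈ Y → t y ≡ i ∷ drop 1 (t y)
    tail≡ y∈ with starts y∈
    ... | s , eq = trans eq (cong (λ r → i ∷ drop 1 r) (sym eq))

  rooting-shattered : (G : GraphOn n) → ∀ {d} → Rooting d G → ∀ X → Piece G X X → Shattered G (suc d) 1 X
  rooting-shattered G {d} R X (piece ne cX _) = labels-shattered G (suc d) label X ne
    (λ {x} _ → s≤s (subst (_≤ d) (sym (steps-length (path x))) (short x)))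
    -- Labels are injective only for a fixed root, and a connected set has a single root.
    (λ x∈X y∈X → label-injective (same-root (cX x∈X y∈X)))
    (λ _ _ e → [ (λ eq → inj₁ (_ ∷ [] , sym eq)) , (λ eq → inj₂ (_ ∷ [] , sym eq)) ]′ (label-edge e))
    where
    open Rooting R
    same-root : ∀ {x y} → Reach G X x y → root x ≡ root y
    same-root ε = refl
    same-root ((_ , _ , e) ◅ p) = trans (same e) (same-root p)

  -- The vertices of `S` get the empty label; elsewhere the representative of a component is
  -- prefixed to the labels inside it. The last conclusion serves the forest case, where `S` is
  -- empty and hence no label is.
  label-step : (G : GraphOn n) → ∀ d {w} X S → length S ≤ w →
               (∀ Y → Piece G X Y → Avoids S Y → ∃[ t ] Labelling {A = Fin n} G d w Y t) →
               ∃[ t ] Labelling {A = Fin n} G (suc d) w X t × (∀ x → t x ≡ [] → x List.∈ S)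
  label-step {n} G d {w} X S S≤w labels =
    t , record { short = short ; comparable = comparable ; fibre = fibre } , λ x →
        root∈S x (em {x List.∈ S})
    where
    X′ : Subset n
    X′ = ⟦ (λ x → x ∈ X × ¬ x List.∈ S) ⟧

    open Representative G X′

    sub : ∀ c → ∃[ t ] (c ∈ X′ → Labelling G d w (comp G X′ c) t)
    sub c with c ∈? X′
    -- A dummy labelling for letters that represent no component.
    ... | no c∉  = const [] , λ c∈ → contradiction c∈ c∉
    ... | yes c∈ with labels (comp G X′ c) (piece-mono (proj₁ ∘ ∈⟦⟧⁻) (comp-piece G c∈))
          (λ y∈ → proj₂ (∈⟦⟧⁻ (comp-⊆ G y∈)))
    ... | t , L = t , λ _ → L

    labelled : ∀ x → Dec (x List.∈ S) → List (Fin n)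
    labelled x (yes _) = []
    labelled x (no _)  = rep x ∷ proj₁ (sub (rep x)) x

    t : Fin n → List (Fin n)
    t x = labelled x em

    root∈S : ∀ x (dec : Dec (x List.∈ S)) → labelled x dec ≡ [] → x List.∈ S
    root∈S x (yes x∈S) _ = x∈S

    L : ∀ {x} → x ∈ X′ → Labelling G d w (comp G X′ (rep x)) (proj₁ (sub (rep x)))
    L {x} x∈ = proj₂ (sub (rep x)) (rep∈ x∈)

    in-comp : ∀ {x} → x ∈ X′ → x ∈ comp G X′ (rep x)
    in-comp {x} x∈ = ∈⟦⟧⁺ (x∈ , reach-sym G (reach-rep x))

    short : ∀ {x} → x ∈ X → length (t x) < suc d
    short {x} x∈X with em {x List.∈ S}
    ... | yes _ = s≤s z≤n
    ... | no x∉S = s≤s (Labelling.short (L (∈⟦⟧⁺ (x∈X , x∉S))) (in-comp (∈⟦⟧⁺ (x∈X , x∉S))))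

    comparable : ∀ {x y} → x ∈ X → y ∈ X → E G x y → Comparable (t x) (t y)
    comparable {x} {y} x∈X y∈X e with em {x List.∈ S} | em {y List.∈ S}
    ... | yes _  | _      = inj₁ (_ , refl)
    ... | no _   | yes _  = inj₂ (_ , refl)
    ... | no x∉S | no y∉S with rep-cong {x} {y} ((∈⟦⟧⁺ (x∈X , x∉S) , ∈⟦⟧⁺ (y∈X , y∉S) , e) ◅ ε)
    ... | eq = go eq (in-comp x∈) (in-comp y∈)
      where
      x∈ : x ∈ X′
      x∈ = ∈⟦⟧⁺ (x∈X , x∉S)
      y∈ : y ∈ X′
      y∈ = ∈⟦⟧⁺ (y∈X , y∉S)
      go : ∀ {c} → rep x ≡ c → x ∈ comp G X′ (rep x) → y ∈ comp G X′ c →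
           Comparable (rep x ∷ proj₁ (sub (rep x)) x) (c ∷ proj₁ (sub c) y)
      go refl x∈c y∈c = Sum.map ⊑-∷ ⊑-∷ (Labelling.comparable (L x∈) x∈c y∈c e)

    fibre : ∀ s → ∃[ F ] length F ≤ w × (∀ {x} → x ∈ X → t x ≡ s → x List.∈ F)
    fibre [] = S , S≤w , λ {x} _ → root∈S x em
    fibre (c ∷ s) with c ∈? X′
    ... | no c∉ = [] , z≤n , λ {x} x∈X → none x∈X em
      where
      none : ∀ {x} → x ∈ X → (dec : Dec (x List.∈ S)) → labelled x dec ≡ c ∷ s → x List.∈ []
      none x∈X (no x∉S) refl = contradiction (rep∈ (∈⟦⟧⁺ (x∈X , x∉S))) c∉
    ... | yes c∈ with Labelling.fibre (proj₂ (sub c) c∈) s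
    ... | F , F≤ , covers = F , F≤ , λ {x} x∈X → covered x∈X em
      where
      covered : ∀ {x} → x ∈ X → (dec : Dec (x List.∈ S)) → labelled x dec ≡ c ∷ s → x List.∈ F
      covered x∈X (no x∉S) refl = covers (in-comp (∈⟦⟧⁺ (x∈X , x∉S))) refl

  shattered-labels : (G : GraphOn n) → ∀ d {w} X → Shattered G d w X →
      ∃[ t ] Labelling {A = Fin n} G d w X t
  shattered-labels G (suc d) X (S , S≤w , f)
    with label-step G d X S S≤w (λ Y p a → shattered-labels G d Y (f Y p a))
  ... | t , L , _ = t , L

  -- Deconstructions from labellings and minors

  width-exists : {H : GraphOn m} {G : GraphOn n} (D : Deconstruction H G) → Fin m → ∀ {k} →
                 (∀ h → ∣ Deconstruction.B D h ∣ ≤ k) →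
                 ∃[ w ] Deconstruction.Width D w × w ≤ k + k
  width-exists {H = H} D h₀ {k} B≤ = proj₁ width , proj₂ width , below (proj₁ (proj₂ width))
    where
    open Deconstruction D
    P : ℕ → Set
    P w = ∃[ h ] ∃[ h′ ] ReflE H h h′ × ∣ B h ∪ B h′ ∣ ≡ w
    below : ∀ {w} → P w → w ≤ k + k
    below (h , h′ , _ , refl) = ≤-trans (∣p∪q∣≤ (B h) (B h′)) (+-mono-≤ (B≤ h) (B≤ h′))
    width : ∃ (IsMax P)
    width = max-exists P (k + k) (λ _ → below) (_ , h₀ , h₀ , inj₂ refl , refl)

  -- Adjacent vertices have comparable labels, so the bag at the longer label contains both; the
  -- nodes whose bags contain a vertex form the cone of its label. A bag collects the fibres of at
  -- most D + 1 prefixes, and the width joins two bags.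
  labels-deconstruction :
    {xs : List (List (Fin k))} → Convex xs → ∀ {D} → (∀ {s} → s List.∈ xs → length s ≤ D) →
        Fin (length xs) →
    (G : GraphOn n) → ∀ {d w} {t : Fin n → List (Fin k)} → Labelling G d w full t → (∀ x → t x List.∈ xs) →
    Σ[ Δ ∈ Deconstruction (stringGraph xs) G ]
      ∃[ v ] Deconstruction.Width Δ v × v ≤ suc D * w + suc D * w
  labels-deconstruction {k} {n} {xs} cvx {D} ≤D j₀ G {d} {w} {t} L t∈ = Δ , width-exists Δ j₀ B≤
    where
    open StringGraph cvx
    open Labelling L

    Bag : Fin (length xs) → Subset n
    Bag j = ⟦ (λ x → t x ⊑ str j) ⟧

    bag : ∀ {x y} → t x ⊑ t y → x ∈ Bag (position (t∈ y))
    bag {x} {y} x⊑y = ∈⟦⟧⁺ (subst (t x ⊑_) (sym (str-position (t∈ y))) x⊑y)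

    together : ∀ {x y z} → x ∈ Bag (position (t∈ z)) → y ∈ Bag (position (t∈ z)) →
               ∃[ h ] ∃[ h′ ] ReflE H h h′ × x ∈ Bag h ∪ Bag h′ × y ∈ Bag h ∪ Bag h′
    together x∈ y∈ = _ , _ , inj₂ refl , x∈p∪q⁺ (inj₁ x∈) , x∈p∪q⁺ (inj₁ y∈)

    Δ : Deconstruction H G
    Δ = record
      { B = Bag
      ; coverage = λ
          { (inj₁ e) → [ (λ x⊑y → together (bag x⊑y) (bag ⊑-refl)) ,
              (λ y⊑x → together (bag ⊑-refl) (bag y⊑x)) ]′ (comparable ∈⊤ ∈⊤ e)
          ; (inj₂ refl) → together (bag ⊑-refl) (bag ⊑-refl) }
      ; connectivity = λ x i∈ j∈ → Star.map (λ (a , b , e) → ∈⟦⟧⁺ a , ∈⟦⟧⁺ b , e)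
          (cone-conn (t∈ x) (∈⟦⟧⁻ i∈) (∈⟦⟧⁻ j∈))
      }

    B≤ : ∀ j → ∣ Bag j ∣ ≤ suc D * w
    B≤ j with prefix-fibres (proj₁ ∘ fibre) (proj₁ ∘ proj₂ ∘ fibre) (str j)
    ... | F , F≤ , covers = ≤-trans (∣p∣≤length (Bag j) F
          (λ {x} x∈ → covers (∈⟦⟧⁻ x∈) (proj₂ (proj₂ (fibre (t x))) ∈⊤ refl)))
                              (≤-trans F≤ (*-monoˡ-≤ w (s≤s (≤D (∈-lookup {xs = xs} j)))))

  -- The bag of `g` holds the vertex whose branch set contains `g`, if there is one. Disjointness
  -- makes it unique, so two bags together have at most two elements.
  minor-deconstruction : {M : GraphOn m} {G : GraphOn n} → Minor M G → Fin n →
                         Σ[ Δ ∈ Deconstruction G M ] ∃[ w ] Deconstruction.Width Δ w × w ≤ 2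
  minor-deconstruction {m} {n} {M} {G} μM g₀ = Δ , width-exists Δ g₀ B≤
    where
    open Minor μM

    Bag : Fin n → Subset m
    Bag g = ⟦ (λ i → g ∈ μ i) ⟧

    Δ : Deconstruction G M
    Δ = record
      { B = Bag
      ; coverage = λ
          { (inj₁ e) → let g , g′ , g∈ , g′∈ , e′ = edge e
                       in g , g′ , inj₁ e′ , x∈p∪q⁺ (inj₁ (∈⟦⟧⁺ g∈)) , x∈p∪q⁺ (inj₂ (∈⟦⟧⁺ g′∈))
          ; {i} (inj₂ refl) → let g , g∈ = nonempty i
                              in g , g , inj₂ refl , x∈p∪q⁺ (inj₁ (∈⟦⟧⁺ g∈)) , x∈p∪q⁺ (inj₁ (∈⟦⟧⁺ g∈)) }
      ; connectivity = λ i g∈ g′∈ → Star.map (λ (a , b , e) → ∈⟦⟧⁺ a , ∈⟦⟧⁺ b , e)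
          (connected i (∈⟦⟧⁻ g∈) (∈⟦⟧⁻ g′∈))
      }

    B≤ : ∀ g → ∣ Bag g ∣ ≤ 1
    B≤ g with em {∃[ i ] g ∈ μ i}
    ... | no none = ≤-trans (∣p∣≤length (Bag g) [] (λ i∈ → contradiction (_ , ∈⟦⟧⁻ i∈) none)) z≤n
    ... | yes (i , g∈i) = ∣p∣≤length (Bag g) (i ∷ []) λ {j} j∈ → here (by-contradiction λ j≢i →
                            disjoint j≢i (g , x∈p∩q⁺ (∈⟦⟧⁻ j∈ , g∈i)))

  module _ {G : GraphOn n} {M : GraphOn m} (Δ : Deconstruction G M) where
    open Deconstruction Δ

    private
      support : Subset m → Subset n
      support Y = ⟦ (λ g → ∃[ y ] y ∈ Y × y ∈ B g) ⟧

      support-mono : ∀ {Y Y′} → Y ⊆ Y′ → support Y ⊆ support Y′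
      support-mono Y⊆Y′ g∈ with ∈⟦⟧⁻ g∈
      ... | y , y∈Y , y∈B = ∈⟦⟧⁺ (y , Y⊆Y′ y∈Y , y∈B)

      cover : ∀ {y y′} → ReflE M y y′ → ∃[ a ] ∃[ b ] ReflE G a b × y ∈ B a × y′ ∈ B b
      cover e with coverage e
      ... | h , h′ , hh′ , y∈ , y′∈ with x∈p∪q⁻ (B h) (B h′) y∈ | x∈p∪q⁻ (B h) (B h′) y′∈
      ... | inj₁ a | inj₁ b = h , h , inj₂ refl , a , b
      ... | inj₁ a | inj₂ b = h , h′ , hh′ , a , b
      ... | inj₂ a | inj₁ b = h′ , h , Sum.map (adj-sym G) sym hh′ , a , b
      ... | inj₂ a | inj₂ b = h′ , h′ , inj₂ refl , a , b

      support-conn : ∀ {Y} → Conn M Y → Conn G (support Y)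
      support-conn {Y} cY g∈ g′∈ with ∈⟦⟧⁻ g∈ | ∈⟦⟧⁻ g′∈
      ... | y , y∈Y , y∈g | y′ , y′∈Y , y′∈g′ = link y∈Y (cY y∈Y y′∈Y) y∈g y′∈g′
        where
        within : ∀ {y g h} → y ∈ Y → y ∈ B g → y ∈ B h → Reach G (support Y) g h
        within {y} y∈Y y∈g y∈h =
          Star.map (λ (a , b , e) → ∈⟦⟧⁺ (y , y∈Y , a) , ∈⟦⟧⁺ (y , y∈Y , b) , e) (connectivity y y∈g y∈h)
        link : ∀ {y y′ g g′} → y ∈ Y → Reach M Y y y′ → y ∈ B g → y′ ∈ B g′ → Reach G (support Y) g g′
        link y∈Y ε y∈g y∈g′ = within y∈Y y∈g y∈g′
        link y∈Y ((_ , z∈Y , e) ◅ p) y∈g y′∈g′ with cover (inj₁ e)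
        ... | a , .a , inj₂ refl , y∈a , z∈b = within y∈Y y∈g y∈a ◅◅ link z∈Y p z∈b y′∈g′
        ... | a , b , inj₁ ab , y∈a , z∈b = within y∈Y y∈g y∈a
              ◅◅ (∈⟦⟧⁺ (_ , y∈Y , y∈a) , ∈⟦⟧⁺ (_ , z∈Y , z∈b) , ab) ◅ link z∈Y p z∈b y′∈g′

      support-piece : ∀ {Y} → Piece M Y Y → Piece G (support Y) (support Y)
      support-piece (piece (y , y∈Y) cY _) with cover {y} (inj₂ refl)
      ... | a , _ , _ , y∈a , _ = piece (a , ∈⟦⟧⁺ (y , y∈Y , y∈a)) (support-conn cY) id

    -- The vertices of `G` whose bags meet a connected set form a connected set, its support. A
    -- deleted vertex of `G` is replaced by its whole bag, at most `k` vertices; a piece avoiding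
    -- these bags has a support avoiding the deleted vertices.
    shattered-transfer : ∀ {k} → (∀ g → ∣ B g ∣ ≤ k) → ∀ {w} d → (∀ X → Piece G X X → Shattered G d w X) →
                         ∀ Y → Piece M Y Y → Shattered M d (w * k) Y
    shattered-transfer {k} B≤ {w} d sh Y pY = go d Y pY (sh (support Y) (support-piece pY))
      where
      bags : List (Fin n) → List (Fin m)
      bags = concatMap (λ g → proj₁ (members (B g)))
      bags-length : ∀ S → length (bags S) ≤ length S * k
      bags-length []      = z≤n
      bags-length (g ∷ S) = ≤-trans (≤-reflexive (length-++ (proj₁ (members (B g)))))
        (+-mono-≤ (≤-trans (≤-reflexive (proj₁ (proj₂ (members (B g))))) (B≤ g)) (bags-length S))
      bags∈ : ∀ {g S y} → g List.∈ S → y ∈ B g → y List.∈ bags S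
      bags∈ {S = S} g∈S y∈B = ∈-concatMap⁺ _ (Any.map (λ { refl → proj₂ (proj₂ (members (B _))) y∈B }) g∈S)

      go : ∀ d Y → Piece M Y Y → Shattered G d w (support Y) → Shattered M d (w * k) Y
      go (suc d) Y pY (S , S≤w , f) = bags S , ≤-trans (bags-length S) (*-monoˡ-≤ k S≤w) ,
        λ Z (piece ne cZ Z⊆Y) avoid →
          let piece neS cS _ = support-piece (piece ne cZ id) in
          go d Z (piece ne cZ id) (f (support Z) (piece neS cS (support-mono Z⊆Y))
            λ g∈ g∈S → let y , y∈Z , y∈B = ∈⟦⟧⁻ g∈ in avoid y∈Z (bags∈ g∈S y∈B))

  width-bag : {H : GraphOn m} {G : GraphOn n} (D : Deconstruction H G) → ∀ {w k} →
      Deconstruction.Width D w → w ≤ k →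
              ∀ h → ∣ Deconstruction.B D h ∣ ≤ k
  width-bag D (_ , max) w≤k h = ≤-trans (∣p∣≤∣p∪q∣ (B h) (B h))
      (≤-trans (max _ (h , h , inj₂ refl , refl)) w≤k)
    where open Deconstruction D

  -- Invariant of `go`: `X` contains the cone of `t`, and d further letters still fit. The K child
  -- cones are disjoint, so fewer than K deletions miss one of them, which is then a piece one level
  -- down.
  𝐓-not-shattered : ∀ {h K w} → w < K → ∀ d → d ≤ h → ¬ Shattered (graph (𝐓 h K)) d w full
  𝐓-not-shattered {h} {K} {w} w<K d d≤h sh = go d [] d≤h full (λ _ _ → ∈⊤) sh
    where
    open StringGraph (strings-convex {K} h)

    go : ∀ d t → length t + d ≤ h → ∀ X → (∀ j → t ⊑ str j → j ∈ X) → ¬ Shattered H d w X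
    go (suc d) t le X cone⊆X (S , S≤w , f) = clash (Fin.pigeonhole (≤-trans (s≤s S≤w) w<K) (proj₁ ∘ hit))
      where
      le′ : ∀ i → length (t ∷ʳ i) + d ≤ h
      le′ i = subst (_≤ h) (trans (+-suc (length t) d)
          (cong (_+ d) (sym (trans (length-++ t) (+-comm (length t) 1))))) le

      hit : ∀ i → ∃[ a ] t ∷ʳ i ⊑ str (lookup S a)
      hit i = by-contradiction λ miss → go d (t ∷ʳ i) (le′ i) ⟦ Below ⟧ (λ j below → ∈⟦⟧⁺ {P = Below} below)
        (f ⟦ Below ⟧ (piece (position t∈ , ∈⟦⟧⁺ {P = Below}
            (subst (t ∷ʳ i ⊑_) (sym (str-position t∈)) ⊑-refl))
                         (conn-⟦⟧ H Below (cone-conn t∈))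
                         (λ {j} j∈ → cone⊆X j (⊑-trans (⊑-snoc t i) (∈⟦⟧⁻ {P = Below} j∈))))
             (λ j∈ j∈S → miss (Any.index j∈S , subst Below (Any.lookup-index j∈S) (∈⟦⟧⁻ {P = Below} j∈))))
        where
        Below : Fin (length (strings h K)) → Set
        Below j = t ∷ʳ i ⊑ str j
        t∈ : t ∷ʳ i List.∈ strings h K
        t∈ = ∈strings h (≤-trans (m≤m+n _ d) (le′ i))

      clash : ∃[ i ] ∃[ j ] i Fin.< j × proj₁ (hit i) ≡ proj₁ (hit j) → ⊥
      clash (i , j , i<j , eq) = Fin.<⇒≢ i<j (⊑-branch t (proj₂ (hit i))
        (subst (λ a → t ∷ʳ j ⊑ str (lookup S a)) (sym eq) (proj₂ (hit j))))

  -- Elimination trees and shattering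

  Elimination : ∀ {N} → GraphOn N → ℕ → Set
  Elimination {N} G h = Σ[ T ∈ GraphOn N ] Tree T × Σ[ r ∈ Fin N ]
      (∃[ l ] RootedHeight T r l × l ≤ h) × (∀ u v → E G u v → Ancestor T r u v ⊎ Ancestor T r v u)

  strings-length₁ : ∀ h → length (strings h 1) ≡ suc h
  strings-length₁ zero = refl
  strings-length₁ (suc h) = cong suc (trans (cong length (++-identityʳ (map (zero ∷_) (strings h 1))))
                                            (trans (length-map (zero ∷_) (strings h 1))
                                                (strings-length₁ h)))

  𝐓-connected : ∀ h k → Connected (graph (𝐓 h k))
  𝐓-connected h k _ _ = Star.map (λ {x} {y} → λ { (_ , _ , e) → tt , tt , e })
      (cone-conn (here refl) (_ , refl) (_ , refl))
    where open StringGraph (strings-convex {k} h)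

  𝐓-pathBound : ∀ h k → PathBound (graph (𝐓 h k)) zero h
  𝐓-pathBound h k {v} p up = ≤-trans (m≤m+n (edges p) 0)
    (≤-trans (root-descend (λ { j (c , eq) → []≢snoc (str j) eq }) p up)
        (strings-length h (∈-lookup {xs = strings h k} v)))
    where
    open StringGraph (strings-convex {k} h)
    []≢snoc : ∀ (s : List (Fin k)) {c} → [] ≢ s ∷ʳ c
    []≢snoc [] ()
    []≢snoc (_ ∷ _) ()

  -- All unary strings are comparable, so the path `𝐓 N 1` eliminates any graph on its vertices.
  -- Hence the minimum in `ConnectedTreeDepth` exists for every component.
  path-elimination : ∀ N → Fin N → (G : GraphOn N) → ∃ (Elimination G)
  path-elimination (suc N) _ = subst (λ N → (G : GraphOn N) → ∃ (Elimination G)) (strings-length₁ N) λ G →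
    let l , rh , _ = rootedHeight H zero {N} (𝐓-pathBound N 1)
    in l , H , (𝐓-connected N 1 , acyclic) , zero , (l , rh , ≤-refl) ,
       λ u v _ → Sum.map (ancestor u v) (ancestor v u) (strings-total (str u) (str v))
    where
    open StringGraph (strings-convex {1} N)
    ancestor : ∀ u v → str u ⊑ str v → Ancestor H zero u v
    ancestor u v u⊑v with connected-path H (𝐓-connected N 1) zero v
    -- A path from the root to `v` missing `u` would stay outside the cone of `u`, in which `v`
    -- lies.
    ... | p , up = p , up , by-contradiction λ u∉ →
          walk-invariant H (λ y → ¬ str u ⊑ str y) u (λ {x} → outside-stay {u} {x}) p u∉
            (λ { (w , eq) → u∉ (subst (List._∈ vertices p)
                (str-injective {zero} {u} (sym (++-[] (str u) eq))) (source∈ p)) }) (target∈ p) u⊑v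
      where
      ++-[] : ∀ (s : List (Fin 1)) {w} → s ++ w ≡ [] → s ≡ []
      ++-[] [] _ = refl

  -- Each vertex is labelled by its path from the root of the elimination tree. Edges of `G` join
  -- ancestors to descendants, so their labels are comparable.
  elimination-shattered : (G : GraphOn n) → ∀ {b C X} → Elimination (induced G C) b → X ⊆ C →
      Nonempty X → Shattered G (suc b) 1 X
  elimination-shattered {n} G {b} {C} {X} (T , (conn , acyc) , r , (l , (_ , max) , l≤b) , anc) X⊆C ne =
    labels-shattered G (suc b) t X ne
      (λ x∈ → let i , _ , t≡ = label-at (X⊆C x∈) in subst (λ s → length s < suc b) (sym t≡) (short i))
      (λ x∈ y∈ eq → let i , ix , tx = label-at (X⊆C x∈) ; j , jy , ty = label-at (X⊆C y∈)
                    in trans (sym ix) (trans (cong emb (steps-injective (path i) (path j)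
                            (trans (sym tx) (trans eq ty)))) jy))
      (λ x∈ y∈ e → let i , ix , tx = label-at (X⊆C x∈) ; j , jy , ty = label-at (X⊆C y∈)
                   in subst₂ Comparable (sym tx) (sym ty)
                        (Sum.map (below i j) (below j i) (anc i j (subst₂ (E G) (sym ix) (sym jy) e))))
    where
    open Induced G C
    path : ∀ v → Walk T r v
    path v = proj₁ (connected-path T conn r v)
    isPath : ∀ v → IsPath (path v)
    isPath v = proj₂ (connected-path T conn r v)
    label : Fin (length (elements C)) → List (Fin (length (elements C)))
    label v = steps (path v)
    short : ∀ v → length (label v) < suc b
    short v = s≤s (≤-trans (≤-reflexive (steps-length (path v)))
        (≤-trans (max _ (v , path v , isPath v , refl)) l≤b))
    below : ∀ i j → Ancestor T r i j → label i ⊑ label j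
    below i j (p , up , i∈) = subst (label i ⊑_) (path-unique T acyc p (path j) up (isPath j))
                                (ancestor-⊑ T acyc (path i) p (isPath i) up i∈)

    t′ : ∀ x → Dec (x ∈ C) → List (Fin (length (elements C)))
    t′ x (yes x∈C) = label (pos x∈C)
    -- A default outside `C`, harmless because `X ⊆ C`.
    t′ x (no _)    = []
    t : Fin n → List (Fin (length (elements C)))
    t x = t′ x (x ∈? C)
    label-at : ∀ {x} → x ∈ C → ∃[ i ] emb i ≡ x × t x ≡ label i
    label-at {x} x∈C with x ∈? C
    ... | yes x∈ = pos x∈ , emb-pos x∈ , refl
    ... | no x∉  = contradiction x∈C x∉

  -- A connected set lies in one component, and the tree depth, being a maximum over components,
  -- bounds the least elimination height there.
  treeDepth-shattered : (G : GraphOn n) → ∀ {h b} → TreeDepth G h → h ≤ b → ∀ X → Piece G X X →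
      Shattered G (suc b) 1 X
  treeDepth-shattered {n} G {h} {b} (_ , max) h≤b X (piece ne@(x , x∈X) cX _) =
    shatter (comp-component G x) (closed-absorbs G (comp-closed G) (λ _ → ∈⊤) cX x∈X (comp-self G ∈⊤))
    where
    shatter : ∀ {C} → Component G C → X ⊆ C → Shattered G (suc b) 1 X
    shatter {C} comp X⊆C =
      let h′ , depth = min-exists (Elimination (induced G C))
              (path-elimination _ (Induced.pos G C (X⊆C x∈X)) (induced G C))
          T , tree , r , (l , rh , l≤h′) , anc = proj₁ depth
      in elimination-shattered G (T , tree , r ,
              (l , rh , ≤-trans l≤h′ (≤-trans (max h′ (C , comp , depth)) h≤b)) , anc) X⊆C ne

-- Models as minors

module _ {k : ℕ} {G : GraphOn n} where

  -- At a leaf only the vertex `u` is taken. Strings that run past a leaf get a default value; the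
  -- disjointness and edge lemmas exclude them by length.
  branch : ∀ {h X u} → Model G k h X u → List (Fin k) → Subset n
  branch (leaf {u = u} _ _) _ = ⁅ u ⁆
  branch (node R _ _ _ _ _ _ _ _ _ _ _) [] = R
  branch (node _ _ _ _ _ _ _ _ _ _ _ sub) (i ∷ s) = branch (sub i) s

  branch-⊆ : ∀ {h X u} → (M : Model G k h X u) → ∀ s → branch M s ⊆ X
  branch-⊆ {X = X} (leaf {u = u} _ u∈X) _ x∈ = subst (_∈ X) (sym (x∈⁅y⁆⇒x≡y u x∈)) u∈X
  branch-⊆ (node _ _ _ _ R⊆X _ _ _ _ _ _ _) [] = R⊆X
  branch-⊆ (node _ _ _ _ _ _ _ C⊆X _ _ _ sub) (i ∷ s) = C⊆X i ∘ branch-⊆ (sub i) s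

  branch-conn : ∀ {h X u} → (M : Model G k h X u) → ∀ s → Conn G (branch M s)
  branch-conn (leaf {u = u} _ _) _ = conn-⁅⁆ G u
  branch-conn (node _ _ _ _ _ cR _ _ _ _ _ _) [] = cR
  branch-conn (node _ _ _ _ _ _ _ _ _ _ _ sub) (i ∷ s) = branch-conn (sub i) s

  branch-root : ∀ {h X u} → (M : Model G k h X u) → u ∈ branch M []
  branch-root (leaf {u = u} _ _) = x∈⁅x⁆ u
  branch-root (node _ _ _ _ _ _ u∈R _ _ _ _ _) = u∈R

  branch-nonempty : ∀ {h X u} → (M : Model G k h X u) → ∀ s → Nonempty (branch M s)
  branch-nonempty M [] = _ , branch-root M
  branch-nonempty (leaf {u = u} _ _) (_ ∷ _) = u , x∈⁅x⁆ u
  branch-nonempty (node _ _ _ _ _ _ _ _ _ _ _ sub) (i ∷ s) = branch-nonempty (sub i) s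

  branch-disjoint : ∀ {h X u} → (M : Model G k h X u) → ∀ s s′ → length s ≤ h → length s′ ≤ h → s ≢ s′ →
                    ∀ {x} → x ∈ branch M s → x ∉ branch M s′
  branch-disjoint M [] [] _ _ s≢s′ _ _ = s≢s′ refl
  branch-disjoint (node _ _ _ _ _ _ _ _ C∩R _ _ sub) [] (j ∷ s′) _ _ _ x∈R x∈ =
      C∩R j (branch-⊆ (sub j) s′ x∈) x∈R
  branch-disjoint (node _ _ _ _ _ _ _ _ C∩R _ _ sub) (i ∷ s) [] _ _ _ x∈ x∈R =
      C∩R i (branch-⊆ (sub i) s x∈) x∈R
  branch-disjoint (node _ _ _ _ _ _ _ _ _ dis _ sub) (i ∷ s) (j ∷ s′) (s≤s s≤) (s≤s s′≤) s≢s′ x∈ x∈′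
      with i Fin.≟ j
  ... | yes refl = branch-disjoint (sub i) s s′ s≤ s′≤ (s≢s′ ∘ cong (i ∷_)) x∈ x∈′
  ... | no i≢j = dis i≢j (branch-⊆ (sub i) s x∈) (branch-⊆ (sub j) s′ x∈′)

  branch-edge : ∀ {h X u} → (M : Model G k h X u) → ∀ s i → length (s ∷ʳ i) ≤ h →
                ∃[ g ] ∃[ g′ ] g ∈ branch M s × g′ ∈ branch M (s ∷ʳ i) × E G g g′
  branch-edge (leaf _ _) [] i ()
  branch-edge (leaf _ _) (_ ∷ _) i ()
  branch-edge (node _ _ _ _ _ _ _ _ _ _ link sub) [] i _ =
    let r , r∈R , e = link i in r , _ , r∈R , branch-root (sub i) , e
  branch-edge (node _ _ _ _ _ _ _ _ _ _ _ sub) (j ∷ s) i (s≤s le) = branch-edge (sub j) s i le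

  model-minor : ∀ {h X u} → Model G k h X u →
                Σ[ M ∈ Minor (graph (𝐓 h k)) G ] (∀ i → Minor.μ M i ⊆ X)
  model-minor {h} M = record
    { μ         = branch M ∘ str
    ; disjoint  = λ {i} {j} i≢j (x , x∈) → let x∈i , x∈j = x∈p∩q⁻ (branch M (str i)) (branch M (str j)) x∈
                                           in branch-disjoint M (str i) (str j) (str≤ i) (str≤ j)
                                                   (i≢j ∘ str-injective) x∈i x∈j
    ; nonempty  = branch-nonempty M ∘ str
    ; connected = λ i → branch-conn M (str i)
    ; edge      = λ {i} {j} e → edge i j (E⁻ {i} {j} e)
    } , λ i → branch-⊆ M (str i)
    where
    open StringGraph (strings-convex {k} h)
    str≤ : ∀ i → length (str i) ≤ h
    str≤ i = strings-length h (∈-lookup {xs = strings h k} i)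
    child-edge : ∀ i j → Child (str i) (str j) →
        ∃[ g ] ∃[ g′ ] g ∈ branch M (str i) × g′ ∈ branch M (str j) × E G g g′
    child-edge i j (c , eq) = subst
      (λ s → ∃[ g ] ∃[ g′ ] g ∈ branch M (str i) × g′ ∈ branch M s × E G g g′) (sym eq)
      (branch-edge M (str i) c (subst (λ s → length s ≤ h) eq (str≤ j)))
    edge : ∀ i j → Child (str i) (str j) ⊎ Child (str j) (str i) →
           ∃[ g ] ∃[ g′ ] g ∈ branch M (str i) × g′ ∈ branch M (str j) × E G g g′
    edge i j (inj₁ ch) = child-edge i j ch
    edge i j (inj₂ ch) = let g , g′ , g∈ , g′∈ , e = child-edge j i ch in g′ , g , g′∈ , g∈ , adj-sym G e

-- A vertex v goes to the branch set of its label in the model belonging to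
-- the root of v.
rooting-minor : ∀ {d} (F : GraphOn m) (R : Rooting d F) (G : GraphOn n)
    (M : Fin m → Minor (graph (𝐓 d m)) G) →
                (∀ {u v} → Rooting.root R u ≢ Rooting.root R v → ∀ i j {x} →
                   x ∈ Minor.μ (M (Rooting.root R u)) i → x ∉ Minor.μ (M (Rooting.root R v)) j) →
                Minor F G
rooting-minor {m} {n} {d} F R G M apart = record
  { μ         = μ
  ; disjoint  = λ { {u} {v} u≢v (x , x∈) →
      let x∈u , x∈v = x∈p∩q⁻ (μ u) (μ v) x∈ in separate u v u≢v x∈u x∈v }
  ; nonempty  = λ v → Minor.nonempty (M (root v)) (position (label∈ v))
  ; connected = λ v → Minor.connected (M (root v)) (position (label∈ v))
  ; edge      = λ {u} {v} e → linked u v (same e) (adjacent-labels e)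
  }
  where
  open Rooting R
  open StringGraph (strings-convex {m} d)

  label∈ : ∀ v → label v List.∈ strings d m
  label∈ v = ∈strings d (subst (_≤ d) (sym (steps-length (path v))) (short v))

  μ : Fin m → Subset n
  μ v = Minor.μ (M (root v)) (position (label∈ v))

  position-injective : ∀ u v → position (label∈ u) ≡ position (label∈ v) → label u ≡ label v
  position-injective u v eq = trans (sym (str-position (label∈ u)))
      (trans (cong str eq) (str-position (label∈ v)))

  separate : ∀ u v → u ≢ v → ∀ {x} → x ∈ μ u → x ∉ μ v
  separate u v u≢v x∈u x∈v with root u Fin.≟ root v
  ... | no ≢r = apart ≢r _ _ x∈u x∈v
  ... | yes ≡r = Minor.disjoint (M (root u))
                   (λ eq → u≢v (label-injective ≡r (position-injective u v eq)))
                   (_ , x∈p∩q⁺ (x∈u , subst (λ r → _ ∈ Minor.μ (M r) (position (label∈ v))) (sym ≡r) x∈v))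

  adjacent-labels : ∀ {u v} → E F u v → E H (position (label∈ u)) (position (label∈ v))
  adjacent-labels {u} {v} e = E⁺ {position (label∈ u)} {position (label∈ v)}
      ([ (λ eq → inj₁ (v , at v u eq)) , (λ eq → inj₂ (u , at u v eq)) ]′ (label-edge e))
    where
    at : ∀ a b {c} → label a ≡ label b ∷ʳ c → str (position (label∈ a)) ≡ str (position (label∈ b)) ∷ʳ c
    at a b eq = trans (str-position (label∈ a)) (trans eq (cong (_∷ʳ _) (sym (str-position (label∈ b)))))

  linked : ∀ u v → root u ≡ root v → E H (position (label∈ u)) (position (label∈ v)) →
           ∃[ g ] ∃[ g′ ] g ∈ μ u × g′ ∈ μ v × E G g g′
  linked u v ≡r e =
    let g , g′ , g∈ , g′∈ , e′ = Minor.edge (M (root u)) e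
    in g , g′ , g∈ , subst (λ r → g′ ∈ Minor.μ (M r) (position (label∈ v))) ≡r g′∈ , e′

-- Comparing classes of graphs

vertex : (G : Graph) → Fin (order G)
vertex (mkGraph (suc _) _) = zero

module ClassicalClass (em : ExcludedMiddle 0ℓ) where
  open Classical em
  open ClassicalModel em
  open ClassicalHeight em
  open ClassicalLabel em

  𝒯-rooting : ∀ {d} G → 𝒯 d G → Rooting d (graph G)
  𝒯-rooting G G∈ = tree-rooting (graph G) (proj₁ G∈) (proj₂ (𝒯-pathBound G G∈))

  𝐓∈𝒯 : ∀ d k → 𝒯 d (𝐓 d k)
  𝐓∈𝒯 d k = (𝐓-connected d k , StringGraph.acyclic (strings-convex d)) ,
             treeHeight (graph (𝐓 d k)) zero (𝐓-pathBound d k)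

  𝐓-full : ∀ h k → Piece (graph (𝐓 h k)) full full
  𝐓-full h k = piece (zero , ∈⊤) (λ _ _ →
      walk-reach (graph (𝐓 h k)) (proj₁ (connected-path (graph (𝐓 h k)) (𝐓-connected h k) _ _))) id

  𝐓∈ℱ : ∀ d k → ℱ d (𝐓 d k)
  𝐓∈ℱ d k = StringGraph.acyclic (strings-convex d) ,
    forestHeight (graph (𝐓 d k)) zero λ v → zero , Piece.conn (𝐓-full d k) ∈⊤ ∈⊤ , 𝐓-pathBound d k

  -- The disjoint union of k copies of 𝐓 d k: 𝐓 (d + 1) k without its root.
  forest : ∀ d k → Fin k → Graph
  forest d k i = mkGraph (length (nonEmptyStrings (suc d) k))
    {{Fin.nonZeroIndex (StringGraph.position (nonEmptyStrings-convex {k} d)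
        (∈nonEmptyStrings d {i} {[]} z≤n))}}
    (stringGraph (nonEmptyStrings (suc d) k))

  forest∈ℱ : ∀ d k i → ℱ d (forest d k i)
  forest∈ℱ d k i = acyclic , forestHeight H (position (∈nonEmptyStrings d {i} {[]} z≤n)) rooted
    where
    open StringGraph (nonEmptyStrings-convex {k} d)

    rootAt : ∀ v c s → str v ≡ c ∷ s → ∃[ r ] Reach H full v r × PathBound H r d
    -- The root has length 1 and no string is longer than d + 1, which leaves d edges.
    rootAt v c s eq = r , reach , λ {y} p up → ≤-pred (≤-trans (≤-reflexive (+-comm 1 (edges p)))
        (≤-trans (subst (λ t → edges p + length t ≤ length (str y)) r≡ (root-descend parentless p up))
                 (nonEmptyStrings-length (suc d) (∈-lookup {xs = nonEmptyStrings (suc d) k} y))))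
      where
      c∈ = ∈nonEmptyStrings d {c} {[]} z≤n
      r = position c∈
      r≡ : str r ≡ c ∷ []
      r≡ = str-position c∈
      reach : Reach H full v r
      reach = Star.map (λ (_ , _ , e) → ∈⊤ , ∈⊤ , e)
        (cone-conn c∈ (s , sym eq) ([] , sym r≡))
      parentless : ∀ j → ¬ Child (str j) (str r)
      parentless j (_ , eq′) = []∉nonEmptyStrings (suc d)
        (subst (List._∈ _) (no-parent (str j) (trans (sym r≡) eq′))
            (∈-lookup {xs = nonEmptyStrings (suc d) k} j))
        where
        no-parent : ∀ t {c′} → c ∷ [] ≡ t ∷ʳ c′ → t ≡ []
        no-parent [] _ = refl
        no-parent (_ ∷ []) ()
        no-parent (_ ∷ _ ∷ _) ()

    rooted : ∀ v → ∃[ r ] Reach H full v r × PathBound H r d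
    rooted v with str v in eq
    ... | []    = contradiction (subst (List._∈ _) eq (∈-lookup {xs = nonEmptyStrings (suc d) k} v))
          ([]∉nonEmptyStrings (suc d))
    ... | c ∷ s = rootAt v c s eq

  module _ {𝒢 : GraphClass ℓ} where

    shattered⇒≼𝒯 : ∀ {d w} → (∀ G → 𝒢 G → Shattered (graph G) (suc d) w full) → 𝒢 ≼ 𝒯 d
    -- The successor keeps the width bound positive even when `w` is 0.
    shattered⇒≼𝒯 {d} {w} sh = suc W , s≤s z≤n , λ G G∈ →
        deconstruct G (shattered-labels (graph G) (suc d) full (sh G G∈))
      where
      W = suc d * w + suc d * w
      deconstruct : ∀ G → ∃[ t ] Labelling (graph G) (suc d) w full t →
                    ∃[ H ] 𝒯 d H × Σ[ D ∈ Deconstruction (graph H) (graph G) ]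
                      ∃[ v ] Deconstruction.Width D v × v ≤ suc W
      deconstruct G (t , L) =
        let Δ , v , wd , v≤ = labels-deconstruction (strings-convex d) (strings-length d) zero (graph G) L
                                (λ x → ∈strings d (≤-pred (Labelling.short L {x} ∈⊤)))
        in 𝐓 d (order G) , 𝐓∈𝒯 d (order G) , Δ , v , wd , ≤-trans v≤ (n≤1+n W)

    shattered⇒≼ℱ : ∀ {d w} → (∀ G → 𝒢 G → ∀ X → Piece (graph G) X X →
        Shattered (graph G) (suc d) w X) → 𝒢 ≼ ℱ d
    shattered⇒≼ℱ {d} {w} sh = suc W , s≤s z≤n , λ G G∈ → deconstruct G
      -- With nothing deleted at the top, the first letter of a label names the component, and the
      -- labels fit into a forest of height d.
      (label-step (graph G) (suc d) full [] z≤n λ { Y (piece ne cY _) _ →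
        shattered-labels (graph G) (suc d) Y (sh G G∈ Y (piece ne cY id)) })
      where
      W = suc (suc d) * w + suc (suc d) * w
      deconstruct : ∀ G → ∃[ t ] Labelling (graph G) (suc (suc d)) w full t ×
                    (∀ x → t x ≡ [] → x List.∈ []) →
                    ∃[ H ] ℱ d H × Σ[ D ∈ Deconstruction (graph H) (graph G) ]
                      ∃[ v ] Deconstruction.Width D v × v ≤ suc W
      deconstruct G (t , L , noRoot) =
        let Δ , v , wd , v≤ = labels-deconstruction (nonEmptyStrings-convex d)
              (nonEmptyStrings-length (suc d))
              (StringGraph.position (nonEmptyStrings-convex d) (t∈ (vertex G)))
              (graph G) L t∈
        in forest d (order G) (vertex G) , forest∈ℱ d (order G) (vertex G) , Δ , v , wd ,
                ≤-trans v≤ (n≤1+n W)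
        where
        t∈ : ∀ x → t x List.∈ nonEmptyStrings (suc d) (order G)
        t∈ x = at (t x) (λ t≡[] → contradiction (noRoot x t≡[]) λ ()) (Labelling.short L {x} ∈⊤)
          where
          at : ∀ s → s ≢ [] → length s < suc (suc d) → s List.∈ nonEmptyStrings (suc d) (order G)
          at []      s≢[] _ = contradiction refl s≢[]
          at (i ∷ s) _    (s≤s (s≤s s≤d)) = ∈nonEmptyStrings d s≤d

    -- The labels of a tree on m vertices use m letters, so a model of `𝐓 d m` hosts the tree as a
    -- minor.
    minors⇒𝒯≼ : ∀ {d} → (∀ k → 1 ≤ k → minors 𝒢 (𝐓 d k)) → 𝒯 d ≼ 𝒢
    minors⇒𝒯≼ {d} minor = 2 , s≤s z≤n , λ { F@(mkGraph (suc m) _) F∈ →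
      let G , G∈ , M = minor (suc m) (s≤s z≤n)
          Δ , w , wd , w≤ = minor-deconstruction
            (rooting-minor (graph F) (𝒯-rooting F F∈) (graph G) (λ _ → M)
                (λ r≢r → contradiction refl r≢r)) (vertex G)
      in G , G∈ , Δ , w , wd , w≤ }

    -- The family has one component per vertex of the forest, so each root gets a model of its own,
    -- disjoint from the others.
    families⇒ℱ≼ : ∀ {d} → (∀ k → ∃[ G ] 𝒢 G × Family (graph G) (HasModel (graph G) k d) k full) → ℱ d ≼ 𝒢
    families⇒ℱ≼ {d} families = 2 , s≤s z≤n , λ F F∈ →
      let G , G∈ , fam = families (order F)
          M i = model-minor (proj₂ (Family.bad fam i))
          Δ , w , wd , w≤ = minor-deconstruction
            (rooting-minor (graph F) (ℱ-rooting F F∈) (graph G) (proj₁ ∘ M)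
              (λ r≢r′ i j x∈ x∈′ → Family.disjoint fam r≢r′ (proj₂ (M _) i x∈) (proj₂ (M _) j x∈′)))
                  (vertex G)
      in G , G∈ , Δ , w , wd , w≤

    ≼⇒shattered : ∀ {d} {ℋ : GraphClass ℓ′} → (∀ H → ℋ H → Rooting d (graph H)) → 𝒢 ≼ ℋ →
                  ∃[ w ] ∀ G → 𝒢 G → ∀ X → Piece (graph G) X X → Shattered (graph G) (suc d) w X
    -- Rooted graphs are shattered with budget 1, and every deleted vertex pulls back to a bag of at
    -- most `k`.
    ≼⇒shattered {d = d} rooting (k , _ , dec) = 1 * k , λ G G∈ →
      let H , H∈ , Δ , w , wd , w≤k = dec G G∈
      in shattered-transfer Δ (width-bag Δ wd w≤k) (suc d) (rooting-shattered (graph H) (rooting H H∈))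

    module _ (boundedTreeDepth : BoundedTreeDepth 𝒢) where

      private
        b : ℕ
        -- Tree depth counts edges below the root, shattering depth counts levels of vertices.
        b = suc (proj₁ boundedTreeDepth)

        eliminable : ∀ G → 𝒢 G → ∀ X → Piece (graph G) X X → Shattered (graph G) b 1 X
        eliminable G G∈ =
          let h , td , h≤b = proj₂ boundedTreeDepth G G∈ in treeDepth-shattered (graph G) td h≤b

      exclusion⇒shattered : ∀ d k → ¬ minors 𝒢 (𝐓 d k) →
                            ∃[ w ] ∀ G → 𝒢 G → ∀ X → Piece (graph G) X X → Shattered (graph G) d w X
      exclusion⇒shattered d k excluded = w , λ G G∈ X pX →
        [ (λ (_ , mod) → contradiction (G , G∈ , proj₁ (model-minor mod)) excluded) , id ]′
          (dichotomy (graph G) X pX (eliminable G G∈ X pX))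
        where
        w : ℕ
        w = proj₁ (model-or-shattered b d k)
        dichotomy = proj₂ (model-or-shattered b d k)

      -- A component not shattered to depth d within the budget contains a model of `𝐓 d k`, so
      -- there are fewer than k of them and `merge` joins their first deleted sets, at a cost of
      -- `k * w`; the summand `w` pays for the lower levels.
      fewModels⇒shattered : ∀ d k {w} → (∀ G → 𝒢 G → ∀ X → Piece (graph G) X X →
          Shattered (graph G) (suc d) w X) →
                            (∀ G → 𝒢 G → ¬ Family (graph G) (HasModel (graph G) k d) k full) →
                            ∃[ w ] ∀ G → 𝒢 G → Shattered (graph G) (suc d) w full
      fewModels⇒shattered d k {w₁} sh few = k * w + w , λ G G∈ →
        let S , S≤ , f = merge (graph G) {d} {w} k full (pieces G G∈) (few G G∈ ∘ models G G∈)
        in S , ≤-trans S≤ (m≤m+n (k * w) w) , λ Y p a →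
                shattered-mono {G = graph G} d (m≤n+m w (k * w)) id (f Y p a)
        where
        w₂ : ℕ
        w₂ = proj₁ (model-or-shattered b d k)
        dichotomy = proj₂ (model-or-shattered b d k)
        w : ℕ
        w = w₁ + w₂
        pieces : ∀ G → 𝒢 G → ∀ Y → Piece (graph G) full Y → Shattered (graph G) (suc d) w Y
        pieces G G∈ Y (piece ne cY _) = shattered-mono {G = graph G} (suc d) (m≤m+n w₁ w₂) id
            (sh G G∈ Y (piece ne cY id))
        models : ∀ G → 𝒢 G → Family (graph G) (λ C → ¬ Shattered (graph G) d w C) k full →
                 Family (graph G) (HasModel (graph G) k d) k full
        models G G∈ fam = record
          { set = set ; isPiece = isPiece ; closed = closed ; disjoint = disjoint
          ; bad = λ i → let p = piece (Piece.inhabited (isPiece i)) (Piece.conn (isPiece i)) id in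
              [ id , (λ s → contradiction (shattered-mono {G = graph G} d (m≤n+m w₂ w₁) id s) (bad i)) ]′
                (dichotomy (graph G) (set i) p (eliminable G G∈ (set i) p))
          }
          where open Family fam

-- The two directions of the equivalence

module _ (em : ExcludedMiddle ℓ) (𝒢 : GraphClass ℓ) (boundedTreeDepth : BoundedTreeDepth 𝒢) (d : ℕ) where
  private em₀ = excludedMiddle₀ em
  open Classical em₀
  open ClassicalModel em₀
  open ClassicalHeight em₀
  open ClassicalLabel em₀
  open ClassicalClass em₀

  private
    ¬∀⇒∃¬ : {P : ℕ → Set ℓ} → ¬ (∀ k → P k) → ∃[ k ] ¬ P k
    ¬∀⇒∃¬ ¬all = Dec.decidable-stable em λ none → ¬all λ k → Dec.decidable-stable em λ ¬p → none (k , ¬p)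

  stackDepth⇒≋ : StackDepth 𝒢 d → (𝒢 ≋ 𝒯 d) ⊎ (𝒢 ≋ ℱ d)
  stackDepth⇒≋ (minor , max) = compare
      (em {∀ k → ∃[ G ] 𝒢 G × Family (graph G) (HasModel (graph G) k d) k full})
    where
    shattered : ∃[ w ] ∀ G → 𝒢 G → ∀ X → Piece (graph G) X X → Shattered (graph G) (suc d) w X
    shattered =
      -- If `𝐓 (suc d) k` were a minor for all k, maximality would give `suc d ≤ d`.
      let k , ¬minor = ¬∀⇒∃¬ (<-irrefl refl ∘ max (suc d))
      in exclusion⇒shattered boundedTreeDepth (suc d) k (λ M → ¬minor (λ _ → M))

    compare : Dec (∀ k → ∃[ G ] 𝒢 G × Family (graph G) (HasModel (graph G) k d) k full) →
        (𝒢 ≋ 𝒯 d) ⊎ (𝒢 ≋ ℱ d)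
    compare (yes families) = inj₂ (shattered⇒≼ℱ (proj₂ shattered) , families⇒ℱ≼ families)
    compare (no ¬families) =
      let k , few = ¬∀⇒∃¬ ¬families
          w , sh = fewModels⇒shattered boundedTreeDepth d k (proj₂ shattered)
              (λ G G∈ fam → few (G , G∈ , fam))
      in inj₁ (shattered⇒≼𝒯 sh , minors⇒𝒯≼ minor)

  -- Shattering travels along both comparisons. If some `𝐓 d k` were excluded, `𝒢` would be
  -- shattered to depth d, and through `ℋ ≼ 𝒢` so would all `𝐓 d K`. Conversely `𝒢 ≼ ℋ` shatters `𝒢`
  -- to depth d + 1, which rules out large minors `𝐓 h K` with h > d.
  ≋⇒stackDepth : {ℋ : GraphClass 0ℓ} → (∀ H → ℋ H → Rooting d (graph H)) → (∀ k → ℋ (𝐓 d k)) →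
                 𝒢 ≋ ℋ → StackDepth 𝒢 d
  ≋⇒stackDepth {ℋ} rooting 𝐓∈ (𝒢≼ℋ , c , _ , dec) = (λ k _ → Dec.decidable-stable em (excluded k)) , bound
    where
    excluded : ∀ k → ¬ ¬ minors 𝒢 (𝐓 d k)
    excluded k ¬minor =
      let w , sh = exclusion⇒shattered boundedTreeDepth d k ¬minor
          -- One more than the budget obtained for `𝐓 d K` by transfer along bags of size at most
          -- `c`.
          K = suc (w * c)
          G , G∈ , Δ , v , wd , v≤c = dec (𝐓 d K) (𝐓∈ K)
      in 𝐓-not-shattered {d} {K} ≤-refl d ≤-refl
              (shattered-transfer Δ (width-bag Δ wd v≤c) d (sh G G∈) full (𝐓-full d K))

    bound : ∀ h → (∀ k → 1 ≤ k → minors 𝒢 (𝐓 h k)) → h ≤ d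
    bound h minor = by-contradiction λ h≰d →
      let w , sh = ≼⇒shattered rooting 𝒢≼ℋ
          -- The factor 2 is the width of a deconstruction obtained from a minor.
          K = suc (w * 2)
          G , G∈ , M = minor K (s≤s z≤n)
          Δ , v , wd , v≤2 = minor-deconstruction M (vertex G)
      in 𝐓-not-shattered {h} {K} ≤-refl (suc d) (≰⇒> h≰d)
           (shattered-transfer Δ (width-bag Δ wd v≤2) (suc d) (sh G G∈) full (𝐓-full h K))

lemma3p23 : ∀ {ℓ : Level} → ExcludedMiddle ℓ →
    (𝒢 : GraphClass ℓ) → BoundedTreeDepth 𝒢 → (d : ℕ) →
    StackDepth 𝒢 d ⇔ ((𝒢 ≋ 𝒯 d) ⊎ (𝒢 ≋ ℱ d))
lemma3p23 em 𝒢 boundedTreeDepth d = mk⇔ (stackDepth⇒≋ em 𝒢 boundedTreeDepth d)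
  [ ≋⇒stackDepth em 𝒢 boundedTreeDepth d 𝒯-rooting (𝐓∈𝒯 d)
  , ≋⇒stackDepth em 𝒢 boundedTreeDepth d ℱ-rooting (𝐓∈ℱ d) ]′
  where
  open ClassicalHeight (excludedMiddle₀ em)
  open ClassicalClass (excludedMiddle₀ em)
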